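{- (1) There exist $\Pi^0_1$ sets $P,Q\subseteq 2^{\mathbb N}$ such that $P\equiv^{<\omega}_1Q$ holds but $Q\not\le^1_\omega P$. (2) There exist $\Pi^0_1$ sets $P,Q\subseteq 2^{\mathbb N}$ such that $P\equiv^{<\omega}_\omega Q$ holds but $P<^1_\omega Q$.
   Context: Let $\{\Phi_e\}_{e\in\mathbb N}$ be an effective enumeration of all partial computable functions $\Phi_e:\subseteq\mathbb N^{\mathbb N}\to\mathbb N^{\mathbb N}$. A learner is a total computable function $\Psi:\mathbb N^{<\mathbb N}\to\mathbb N$; let $\{\Psi_e\}_{e\in\mathbb N}$ be an effective enumeration of all learners. A partial function $\Gamma:\subseteq\mathbb N^{\mathbb N}\to\mathbb N^{\mathbb N}$ is identified by $\Psi$ on $g$ if $\lim_n\Psi(g\upharpoonright n)$ exists and $\Phi_{\lim_n\Psi(g\upharpoonright n)}(g)=\Gamma(g)$. $\Gamma$ is $(1,\omega)$-computable if some single learner identifies it on every $g\in\mathrm{dom}(\Gamma)$. $\Gamma$ is $(<\omega,1)$-computable if there is $b\in\mathbb N$ such that for every $g\in\mathrm{dom}(\Gamma)$, $\Gamma(g)=\Phi_e(g)$ for some $e<b$. $\Gamma$ is $(<\omega,\omega)$-computable if there is $b\in\mathbb N$ such that for every $g\in\mathrm{dom}(\Gamma)$, $\Gamma$ is identified by $\Psi_e$ on $g$ for some $e<b$. For $A,B\subseteq\mathbb N^{\mathbb N}$, $A\le^\alpha_\beta B$ means there is an $(\alpha,\beta)$-computable partial function $\Gamma$ with $B\subseteq\mathrm{dom}(\Gamma)$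 and $\Gamma(g)\in A$ for every $g\in B$. $A\equiv^\alpha_\beta B$ means $A\le^\alpha_\beta B$ and $B\le^\alpha_\beta A$; $A<^\alpha_\beta B$ means $A\le^\alpha_\beta B$ and $B\not\le^\alpha_\beta A$. -}

module Defs where

open import Level using (0ℓ)
open import Data.List using (List; []; _∷_; applyUpTo)
open import Data.Nat using (ℕ; zero; suc; _+_; _⊔_; _≤_; _<_; s≤s)
open import Data.Nat.Properties
  using (+-suc; +-identityʳ; <-cmp; m⊔n≤o⇒m≤o; m⊔n≤o⇒n≤o; m≤m⊔n; m≤n⊔m)
open import Data.Product using (∃-syntax; _×_; _,_; proj₁; proj₂)
open import Data.Sum using (_⊎_)
open import Function.Base using (const)
open import Function.Bundles using (_⇔_)
open import Relation.Binary.Definitions using (tri<; tri≈; tri>)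
open import Relation.Binary.PropositionalEquality
  using (_≡_; _≗_; refl; sym; trans; cong; cong₂)
open import Relation.Nullary using (¬_; contradiction)
open import Relation.Unary using (Pred; _⊆_)

Baire : Set
Baire = ℕ → ℕ

-- Cantor space, as a subset of Baire space.
2^ℕ : Pred Baire 0ℓ
2^ℕ x = ∀ n → x n < 2

infix 30 _↾_
_↾_ : Baire → ℕ → List ℕ
g ↾ n = applyUpTo g n

-- The Cantor pairing ⟨x , y⟩ = (x + y)(x + y + 1)/2 + y; its inverse walks
-- along the antidiagonals.

triangle : ℕ → ℕ
triangle zero    = zero
triangle (suc s) = suc (s + triangle s)

pairℕ : ℕ → ℕ → ℕ
pairℕ x y = y + triangle (y + x)

next : ℕ × ℕ → ℕ × ℕ
next (zero  , y) = suc y , zero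
next (suc x , y) = x , suc y

unpairℕ : ℕ → ℕ × ℕ
unpairℕ zero    = zero , zero
unpairℕ (suc n) = next (unpairℕ n)

π₁ π₂ : ℕ → ℕ
π₁ n = proj₁ (unpairℕ n)
π₂ n = proj₂ (unpairℕ n)

private
  walk : ∀ {n} x y → unpairℕ n ≡ (y + x , 0) → unpairℕ (y + n) ≡ (x , y)
  walk x zero    eq = eq
  walk x (suc y) eq =
    cong next (walk (suc x) y (trans eq (cong (_, 0) (sym (+-suc y x)))))

  unpair-triangle : ∀ s → unpairℕ (triangle s) ≡ (s , 0)
  unpair-triangle zero    = refl
  unpair-triangle (suc s) =
    cong next (walk 0 s (trans (unpair-triangle s) (cong (_, 0) (sym (+-identityʳ s)))))

  pair-next : ∀ p → pairℕ (proj₁ (next p)) (proj₂ (next p)) ≡ suc (pairℕ (proj₁ p) (proj₂ p))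
  pair-next (zero  , y) = cong (λ s → suc (y + triangle s)) (sym (+-identityʳ y))
  pair-next (suc x , y) = cong (λ s → suc (y + triangle s)) (sym (+-suc y x))

unpair-pair : ∀ x y → unpairℕ (pairℕ x y) ≡ (x , y)
unpair-pair x y = walk x y (unpair-triangle (y + x))

pair-unpair : ∀ n → pairℕ (π₁ n) (π₂ n) ≡ n
pair-unpair zero    = refl
pair-unpair (suc n) = trans (pair-next (unpairℕ n)) (cong suc (pair-unpair n))

codeList : List ℕ → ℕ
codeList []      = zero
codeList (x ∷ σ) = suc (pairℕ x (codeList σ))

-- Programs for the unary partial functions that are partial recursive in an
-- oracle, several arguments being passed as one paired number.
data Code : Set where
  zeroᶜ succᶜ leftᶜ rightᶜ oracleᶜ : Code
  pairᶜ compᶜ precᶜ                : Code → Code → Code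
  rfindᶜ                           : Code → Code

-- The graph of the function defined by primitive recursion from R and S, with
-- parameter a: f(0) = R(a) and f(n+1) = S⟨a , ⟨n , f(n)⟩⟩.
PrimRec : (R S : ℕ → ℕ → Set) → ℕ → ℕ → ℕ → Set
PrimRec R S a zero    y = R a y
PrimRec R S a (suc n) y = ∃[ z ] PrimRec R S a n z × S (pairℕ a (pairℕ n z)) y

-- ⟦ c ⟧ g x y: with oracle g, program c halts on input x with output y.
⟦_⟧ : Code → Baire → ℕ → ℕ → Set
⟦ zeroᶜ ⟧ g x y     = y ≡ 0
⟦ succᶜ ⟧ g x y     = y ≡ suc x
⟦ leftᶜ ⟧ g x y     = y ≡ π₁ x
⟦ rightᶜ ⟧ g x y    = y ≡ π₂ x
⟦ oracleᶜ ⟧ g x y   = y ≡ g x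
⟦ pairᶜ c d ⟧ g x y = ∃[ u ] ∃[ v ] ⟦ c ⟧ g x u × ⟦ d ⟧ g x v × y ≡ pairℕ u v
⟦ compᶜ c d ⟧ g x y = ∃[ z ] ⟦ d ⟧ g x z × ⟦ c ⟧ g z y
⟦ precᶜ c d ⟧ g x y = PrimRec (⟦ c ⟧ g) (⟦ d ⟧ g) (π₁ x) (π₂ x) y
⟦ rfindᶜ c ⟧ g x y  =
  ⟦ c ⟧ g (pairℕ x y) 0 × (∀ m → m < y → ∃[ k ] ⟦ c ⟧ g (pairℕ x m) (suc k))

-- Gödel numbers.
⌜_⌝ : Code → ℕ
⌜ zeroᶜ ⌝     = pairℕ 0 0
⌜ succᶜ ⌝     = pairℕ 1 0
⌜ leftᶜ ⌝     = pairℕ 2 0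
⌜ rightᶜ ⌝    = pairℕ 3 0
⌜ oracleᶜ ⌝   = pairℕ 4 0
⌜ pairᶜ c d ⌝ = pairℕ 5 (pairℕ ⌜ c ⌝ ⌜ d ⌝)
⌜ compᶜ c d ⌝ = pairℕ 6 (pairℕ ⌜ c ⌝ ⌜ d ⌝)
⌜ precᶜ c d ⌝ = pairℕ 7 (pairℕ ⌜ c ⌝ ⌜ d ⌝)
⌜ rfindᶜ c ⌝  = pairℕ 8 ⌜ c ⌝

-- An index that is not a Gödel number denotes the nowhere defined function.
φ : ℕ → Baire → ℕ → ℕ → Set
φ e g x y = ∃[ c ] ⌜ c ⌝ ≡ e × ⟦ c ⟧ g x y

-- Φ e g h: the value Φₑ(g) is defined and is h.
Φ : ℕ → Baire → Baire → Set
Φ e g h = ∀ n → φ e g n (h n)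

private
  -- Left inverse of the Gödel numbering on programs of depth at most the fuel.
  decode  : ℕ → ℕ → Code
  decode′ : ℕ → ℕ × ℕ → Code
  decode zero    n = zeroᶜ
  decode (suc k) n = decode′ k (unpairℕ n)
  decode′ k (0 , _) = zeroᶜ
  decode′ k (1 , _) = succᶜ
  decode′ k (2 , _) = leftᶜ
  decode′ k (3 , _) = rightᶜ
  decode′ k (4 , _) = oracleᶜ
  decode′ k (5 , m) = pairᶜ (decode k (π₁ m)) (decode k (π₂ m))
  decode′ k (6 , m) = compᶜ (decode k (π₁ m)) (decode k (π₂ m))
  decode′ k (7 , m) = precᶜ (decode k (π₁ m)) (decode k (π₂ m))
  decode′ k (_ , m) = rfindᶜ (decode k m)

  depth : Code → ℕ
  depth (pairᶜ c d) = suc (depth c ⊔ depth d)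
  depth (compᶜ c d) = suc (depth c ⊔ depth d)
  depth (precᶜ c d) = suc (depth c ⊔ depth d)
  depth (rfindᶜ c)  = suc (depth c)
  depth _           = 1

  module _ (k : ℕ) where
    tagged : ∀ t m → decode (suc k) (pairℕ t m) ≡ decode′ k (t , m)
    tagged t m = cong (decode′ k) (unpair-pair t m)

    both : (K : Code → Code → Code) {c d : Code} (m n : ℕ) →
           decode k m ≡ c → decode k n ≡ d →
           K (decode k (π₁ (pairℕ m n))) (decode k (π₂ (pairℕ m n))) ≡ K c d
    both K m n p q = cong₂ K
      (trans (cong (λ u → decode k (proj₁ u)) (unpair-pair m n)) p)
      (trans (cong (λ u → decode k (proj₂ u)) (unpair-pair m n)) q)

  decode-⌜⌝ : ∀ k c → depth c ≤ k → decode k ⌜ c ⌝ ≡ c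
  decode-⌜⌝ (suc k) zeroᶜ       _       = tagged k 0 0
  decode-⌜⌝ (suc k) succᶜ       _       = tagged k 1 0
  decode-⌜⌝ (suc k) leftᶜ       _       = tagged k 2 0
  decode-⌜⌝ (suc k) rightᶜ      _       = tagged k 3 0
  decode-⌜⌝ (suc k) oracleᶜ     _       = tagged k 4 0
  decode-⌜⌝ (suc k) (pairᶜ c d) (s≤s h) = trans (tagged k 5 (pairℕ ⌜ c ⌝ ⌜ d ⌝))
    (both k pairᶜ ⌜ c ⌝ ⌜ d ⌝ (decode-⌜⌝ k c (m⊔n≤o⇒m≤o _ _ h)) (decode-⌜⌝ k d (m⊔n≤o⇒n≤o _ _ h)))
  decode-⌜⌝ (suc k) (compᶜ c d) (s≤s h) = trans (tagged k 6 (pairℕ ⌜ c ⌝ ⌜ d ⌝))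
    (both k compᶜ ⌜ c ⌝ ⌜ d ⌝ (decode-⌜⌝ k c (m⊔n≤o⇒m≤o _ _ h)) (decode-⌜⌝ k d (m⊔n≤o⇒n≤o _ _ h)))
  decode-⌜⌝ (suc k) (precᶜ c d) (s≤s h) = trans (tagged k 7 (pairℕ ⌜ c ⌝ ⌜ d ⌝))
    (both k precᶜ ⌜ c ⌝ ⌜ d ⌝ (decode-⌜⌝ k c (m⊔n≤o⇒m≤o _ _ h)) (decode-⌜⌝ k d (m⊔n≤o⇒n≤o _ _ h)))
  decode-⌜⌝ (suc k) (rfindᶜ c)  (s≤s h) = trans (tagged k 8 ⌜ c ⌝) (cong rfindᶜ (decode-⌜⌝ k c h))

⌜⌝-injective : ∀ c d → ⌜ c ⌝ ≡ ⌜ d ⌝ → c ≡ d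
⌜⌝-injective c d eq =
  trans (sym (decode-⌜⌝ k c (m≤m⊔n (depth c) (depth d))))
        (trans (cong (decode k) eq) (decode-⌜⌝ k d (m≤n⊔m (depth c) (depth d))))
  where k = depth c ⊔ depth d

PrimRec-functional : ∀ {R S : ℕ → ℕ → Set} →
  (∀ {x y y′} → R x y → R x y′ → y ≡ y′) → (∀ {x y y′} → S x y → S x y′ → y ≡ y′) →
  ∀ a n {y y′} → PrimRec R S a n y → PrimRec R S a n y′ → y ≡ y′
PrimRec-functional r s a zero    p           q             = r p q
PrimRec-functional r s a (suc n) (z , p , p′) (w , q , q′)
  with refl ← PrimRec-functional r s a n p q = s p′ q′

⟦⟧-functional : ∀ c {g x y y′} → ⟦ c ⟧ g x y → ⟦ c ⟧ g x y′ → y ≡ y′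
⟦⟧-functional zeroᶜ   p q = trans p (sym q)
⟦⟧-functional succᶜ   p q = trans p (sym q)
⟦⟧-functional leftᶜ   p q = trans p (sym q)
⟦⟧-functional rightᶜ  p q = trans p (sym q)
⟦⟧-functional oracleᶜ p q = trans p (sym q)
⟦⟧-functional (pairᶜ c d) (u , v , p , q , refl) (u′ , v′ , p′ , q′ , refl) =
  cong₂ pairℕ (⟦⟧-functional c p p′) (⟦⟧-functional d q q′)
⟦⟧-functional (compᶜ c d) (z , p , q) (z′ , p′ , q′)
  with refl ← ⟦⟧-functional d p p′ = ⟦⟧-functional c q q′
⟦⟧-functional (precᶜ c d) {x = x} =
  PrimRec-functional (⟦⟧-functional c) (⟦⟧-functional d) (π₁ x) (π₂ x)
⟦⟧-functional (rfindᶜ c) {y = y} {y′} (p , below) (p′ , below′) with <-cmp y y′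
... | tri≈ _ y≡y′ _ = y≡y′
... | tri< y<y′ _ _ = contradiction (⟦⟧-functional c p (proj₂ (below′ y y<y′))) λ ()
... | tri> _ _ y′<y = contradiction (⟦⟧-functional c p′ (proj₂ (below y′ y′<y))) λ ()

Φ-functional : ∀ e {g h h′} → Φ e g h → Φ e g h′ → h ≗ h′
Φ-functional e p q n with p n | q n
... | c , refl , u | d , eq , v with refl ← ⌜⌝-injective d c eq = ⟦⟧-functional c u v

-- P = {x ∈ 2^ℕ : ∀ n. R(n , x)} for a computable R ⊆ ℕ × 2^ℕ, program e
-- computing the characteristic function of R.
Π⁰₁ : Pred (Pred Baire 0ℓ) 0ℓ
Π⁰₁ P = ∃[ e ] (∀ x → 2^ℕ x → ∀ n → φ e x n 0 ⊎ φ e x n 1)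
             × (∀ x → P x ⇔ (2^ℕ x × (∀ n → φ e x n 1)))

-- Partial functions on Baire space, by their graphs.  Equality of points of
-- Baire space is _≗_.
record PartialFun : Set₁ where
  field
    graph      : Baire → Baire → Set
    functional : ∀ {g h h′} → graph g h → graph g h′ → h ≗ h′
    respects   : ∀ {g g′ h h′} → g ≗ g′ → h ≗ h′ → graph g h → graph g′ h′

  dom : Pred Baire 0ℓ
  dom g = ∃[ h ] graph g h

open PartialFun public

-- Program e computes the total function Ψ; computability without an oracle is
-- computability in the zero oracle.
IsLearner : ℕ → (List ℕ → ℕ) → Set
IsLearner e Ψ = ∀ σ → φ e (const 0) (codeList σ) (Ψ σ)

_convergesTo_ : (ℕ → ℕ) → ℕ → Set
f convergesTo l = ∃[ s ] ∀ n → s ≤ n → f n ≡ l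

-- Φₑ(g) = Γ(g), both sides being defined.
_agreesWith_at_ : ℕ → PartialFun → Baire → Set
e agreesWith Γ at g = ∃[ h ] graph Γ g h × Φ e g h

Identifies : (List ℕ → ℕ) → PartialFun → Baire → Set
Identifies Ψ Γ g = ∃[ l ] ((λ n → Ψ (g ↾ n)) convergesTo l) × (l agreesWith Γ at g)

⟨1,ω⟩ ⟨<ω,1⟩ ⟨<ω,ω⟩ : Pred PartialFun 0ℓ
⟨1,ω⟩ Γ  = ∃[ e ] ∃[ Ψ ] IsLearner e Ψ × (∀ g → dom Γ g → Identifies Ψ Γ g)
⟨<ω,1⟩ Γ = ∃[ b ] ∀ g → dom Γ g → ∃[ e ] e < b × (e agreesWith Γ at g)
-- The learner Ψₑ is the total function computed by program e, indices of
-- non-total programs being skipped.  Any enumeration of all the learners gives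
-- the same notion, which only says that finitely many learners suffice.
⟨<ω,ω⟩ Γ = ∃[ b ] ∀ g → dom Γ g → ∃[ e ] e < b × (∃[ Ψ ] IsLearner e Ψ × Identifies Ψ Γ g)

infix 4 _≤[_]_ _≰[_]_ _≡[_]_ _<[_]_

-- A ≤[ ⟨α,β⟩ ] B is A ≤^α_β B, and similarly for the other relations.
_≤[_]_ _≰[_]_ _≡[_]_ _<[_]_ : Pred Baire 0ℓ → Pred PartialFun 0ℓ → Pred Baire 0ℓ → Set₁
A ≤[ C ] B = ∃[ Γ ] C Γ × B ⊆ dom Γ × (∀ g → B g → ∀ h → graph Γ g h → A h)
A ≰[ C ] B = ¬ (A ≤[ C ] B)
A ≡[ C ] B = A ≤[ C ] B × B ≤[ C ] A
A <[ C ] B = A ≤[ C ] B × B ≰[ C ] A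

{-# OPTIONS --safe #-}
module Submission where

-- Points x bounded by a fast growing function base are constrained at each q by forbidding the
-- values killed at q.  Each q is a pair of a side i and a program c, and the values killed at q
-- defeat c as a reduction to side i from any other side: for each guard ρ (a string of length q)
-- one searches for a value v and a finite tree above ρ, all of whose nodes at level n have more
-- children than values will ever be killed at n, such that c outputs v at q on every leaf; the
-- first such v found is killed.  If a tree is found, some point obeying all the other constraints
-- passes through a leaf.  If none is found, a union bound shows that one can obey all the other
-- constraints and forever avoid the strings above which some value has a tree, and then c has no
-- admissible output at q.  Hence the classes for different sides are incomparable.
--
-- Labelled is the sum of the classes for the sides 0 and 1.  A point of Rowwise is a sequence of
-- rows, each labelled with a side, the k-th row obeying the constraints q < k of its side.  One
-- of the labels occurs infinitely often, and the rows with that label yield a point of Labelled;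
-- so two programs suffice.  If a single learner sufficed, by the Baire category theorem a single
-- program would suffice on a nonempty relatively open part of Rowwise.  Its choice of a side i is
-- made after reading finitely many entries; labelling all later rows with 1 ∸ i turns it into a
-- reduction to the side i from the side 1 ∸ i.

open import Defs
open import Axiom.ExcludedMiddle using (ExcludedMiddle)
open import Level using (0ℓ)
open import Data.Empty using (⊥)
open import Data.List using (List; []; _∷_; map; _++_)
open import Data.List.Membership.Propositional using (_∈_)
open import Data.List.Membership.Propositional.Properties using (∈-map⁺; ∈-++⁺ˡ; ∈-++⁺ʳ)
open import Data.List.Relation.Unary.Any using (here; there)
open import Data.Nat
open import Data.Nat.Properties
open import Data.Product using (∃-syntax; _×_; _,_; proj₁; proj₂)
open import Data.Sum using (_⊎_; inj₁; inj₂; [_,_]′)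
open import Data.Unit using (⊤; tt)
open import Function.Base using (_∘_; id)
open import Function.Bundles using (_⇔_; mk⇔; Equivalence)
open import Relation.Binary.Definitions using (tri<; tri≈; tri>)
open import Relation.Binary.PropositionalEquality hiding (J)
open import Relation.Nullary using (¬_; Dec; yes; no; contradiction)
open import Relation.Unary using (Pred)
open Equivalence using (to; from)

-- Arithmetic truth functions and bounded quantifiers

-- Truth values of computable predicates are numbers; the nonzero ones are true.
True : ℕ → Set
True n = 0 < n

-- The truth functions below are instances of this recursor, so that `rec-c` supplies programs for
-- them.
recℕ : ℕ → (ℕ → ℕ → ℕ) → ℕ → ℕ
recℕ z s zero    = z
recℕ z s (suc n) = s n (recℕ z s n)

cond : ℕ → ℕ → ℕ → ℕ
cond b x y = recℕ y (λ _ _ → x) b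

isz sg : ℕ → ℕ
isz n = recℕ 1 (λ _ _ → 0) n
sg n = isz (isz n)

prd : ℕ → ℕ
prd n = recℕ 0 (λ m _ → m) n

sub : ℕ → ℕ → ℕ
sub m n = recℕ m (λ _ a → prd a) n

lt eq : ℕ → ℕ → ℕ
lt m n = isz (sub (suc m) n)
eq m n = isz (sub m n + sub n m)

sum : (ℕ → ℕ) → ℕ → ℕ
sum f n = recℕ 0 (λ i a → f i + a) n

ex all : ℕ → (ℕ → ℕ) → ℕ
ex n f = sum f n
all n f = isz (sum (isz ∘ f) n)

sub≡∸ : ∀ m n → sub m n ≡ m ∸ n
sub≡∸ m zero    = refl
sub≡∸ m (suc n) = trans (cong prd (sub≡∸ m n)) (trans (prd≡pred (m ∸ n)) (pred[m∸n]≡m∸[1+n] m n))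
  where
  prd≡pred : ∀ k → prd k ≡ pred k
  prd≡pred zero    = refl
  prd≡pred (suc k) = refl

True? : ∀ n → Dec (True n)
True? n = 0 <? n

¬True⇒≡0 : ∀ {n} → ¬ True n → n ≡ 0
¬True⇒≡0 {zero}  _ = refl
¬True⇒≡0 {suc n} h = contradiction z<s h

isz-T : ∀ n → True (isz n) ⇔ (¬ True n)
isz-T zero    = mk⇔ (λ _ ()) (λ _ → z<s)
isz-T (suc n) = mk⇔ (λ ()) (λ h → contradiction z<s h)

sg-T : ∀ n → True (sg n) ⇔ True n
sg-T zero    = mk⇔ (λ ()) (λ ())
sg-T (suc n) = mk⇔ (λ _ → z<s) (λ _ → z<s)

sg≤1 : ∀ n → sg n ≤ 1
sg≤1 zero    = z≤n
sg≤1 (suc n) = ≤-refl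

*-T : ∀ m n → True (m * n) ⇔ (True m × True n)
*-T zero    n       = mk⇔ (λ ()) (λ ())
*-T (suc m) zero    = mk⇔ (λ h → contradiction (subst True (*-zeroʳ m) h) λ ()) (λ ())
*-T (suc m) (suc n) = mk⇔ (λ _ → z<s , z<s) (λ _ → z<s)

+-T : ∀ m n → True (m + n) ⇔ (True m ⊎ True n)
+-T zero    n = mk⇔ inj₂ λ { (inj₁ ()) ; (inj₂ h) → h }
+-T (suc m) n = mk⇔ (λ _ → inj₁ z<s) (λ _ → z<s)

lt-T : ∀ m n → True (lt m n) ⇔ (m < n)
lt-T m n rewrite sub≡∸ (suc m) n = mk⇔
  (λ h → m∸n≡0⇒m≤n (¬True⇒≡0 (to (isz-T (suc m ∸ n)) h)))
  (λ h → subst (True ∘ isz) (sym (m≤n⇒m∸n≡0 h)) z<s)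

eq-T : ∀ m n → True (eq m n) ⇔ (m ≡ n)
eq-T m n rewrite sub≡∸ m n | sub≡∸ n m = mk⇔
  (λ h → let z = ¬True⇒≡0 (to (isz-T (m ∸ n + (n ∸ m))) h) in
     ≤-antisym (m∸n≡0⇒m≤n (m+n≡0⇒m≡0 (m ∸ n) z)) (m∸n≡0⇒m≤n (m+n≡0⇒n≡0 (m ∸ n) z)))
  (λ { refl → subst (λ k → True (isz (k + k))) (sym (n∸n≡0 m)) z<s })

ex-T : ∀ n f → True (ex n f) ⇔ (∃[ i ] i < n × True (f i))
ex-T n f = mk⇔ (forth n) (λ (i , i<n , h) → back n i i<n h)
  where
  forth : ∀ n → True (ex n f) → ∃[ i ] i < n × True (f i)
  forth (suc n) h with to (+-T (f n) (ex n f)) h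
  ... | inj₁ p = n , ≤-refl , p
  ... | inj₂ p with i , i<n , q ← forth n p = i , m<n⇒m<1+n i<n , q
  back : ∀ n i → i < n → True (f i) → True (ex n f)
  back (suc n) i i<1+n h with m<1+n⇒m<n∨m≡n i<1+n
  ... | inj₁ i<n  = from (+-T (f n) (ex n f)) (inj₂ (back n i i<n h))
  ... | inj₂ refl = from (+-T (f n) (ex n f)) (inj₁ h)

all-T : ∀ n f → True (all n f) ⇔ (∀ i → i < n → True (f i))
all-T n f = mk⇔ forth back
  where
  forth : True (all n f) → ∀ i → i < n → True (f i)
  forth h i i<n with True? (f i)
  ... | yes p = p
  ... | no ¬p = contradiction
    (from (ex-T n (isz ∘ f)) (i , i<n , from (isz-T (f i)) ¬p))
    (to (isz-T (ex n (isz ∘ f))) h)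
  back : (∀ i → i < n → True (f i)) → True (all n f)
  back h = from (isz-T (ex n (isz ∘ f))) λ e →
    let i , i<n , p = to (ex-T n (isz ∘ f)) e in
    to (isz-T (f i)) p (h i i<n)

cond-true : ∀ {b} x y → True b → cond b x y ≡ x
cond-true {suc b} x y _ = refl

cond-false : ∀ {b} x y → ¬ True b → cond b x y ≡ y
cond-false {zero}  x y _ = refl
cond-false {suc b} x y h = contradiction z<s h

π₁-pair : ∀ x y → π₁ (pairℕ x y) ≡ x
π₁-pair x y = cong proj₁ (unpair-pair x y)

π₂-pair : ∀ x y → π₂ (pairℕ x y) ≡ y
π₂-pair x y = cong proj₂ (unpair-pair x y)

-- Programs for functions of coded environments

-- The argument of f codes an environment of natural numbers, with the innermost
-- variable as its first projection.
Cmp : (Baire → ℕ → ℕ) → Set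
Cmp f = ∃[ c ] ∀ g x → ⟦ c ⟧ g x (f g x)

v0 : Cmp (λ _ x → π₁ x)
v0 = leftᶜ , λ _ _ → refl

tail-c : Cmp (λ _ x → π₂ x)
tail-c = rightᶜ , λ _ _ → refl

-- No basic program is the identity; rebuilding a number from its two projections serves instead.
id-c : Cmp (λ _ x → x)
id-c = compᶜ leftᶜ (pairᶜ d d) , λ g x → pairℕ x x , (x , x , p g x , p g x , refl) , sym (π₁-pair x x)
  where
  d : Code
  d = pairᶜ leftᶜ rightᶜ
  p : ∀ g x → ⟦ d ⟧ g x x
  p g x = π₁ x , π₂ x , refl , refl , sym (pair-unpair x)

module _ {f h : Baire → ℕ → ℕ} where
  comp-c : Cmp f → Cmp h → Cmp (λ g x → f g (h g x))
  comp-c (c , p) (d , q) = compᶜ c d , λ g x → h g x , q g x , p g (h g x)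

  pair-c : Cmp f → Cmp h → Cmp (λ g x → pairℕ (f g x) (h g x))
  pair-c (c , p) (d , q) = pairᶜ c d , λ g x → f g x , h g x , p g x , q g x , refl

module _ {f : Baire → ℕ → ℕ} where
  wk : Cmp f → Cmp (λ g x → f g (π₂ x))
  wk F = comp-c F tail-c

  suc-c : Cmp f → Cmp (λ g x → suc (f g x))
  suc-c F = comp-c (succᶜ , λ _ _ → refl) F

  π₁-c : Cmp f → Cmp (λ g x → π₁ (f g x))
  π₁-c F = comp-c v0 F

  π₂-c : Cmp f → Cmp (λ g x → π₂ (f g x))
  π₂-c F = comp-c tail-c F

  oracle-c : Cmp f → Cmp (λ g x → g (f g x))
  oracle-c F = comp-c (oracleᶜ , λ _ _ → refl) F

const-c : ∀ k → Cmp (λ _ _ → k)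
const-c zero    = zeroᶜ , λ _ _ → refl
const-c (suc k) = suc-c (const-c k)

v1 : Cmp (λ _ x → π₁ (π₂ x))
v1 = wk v0

v2 : Cmp (λ _ x → π₁ (π₂ (π₂ x)))
v2 = wk v1

-- `precᶜ` hands its step the parameter first and the previous value last, while an environment
-- keeps its newest variable first; `reorder` passes from one to the other.
rec-c : ∀ {m z : Baire → ℕ → ℕ} {s : Baire → ℕ → ℕ → ℕ → ℕ} → Cmp m → Cmp z →
  Cmp (λ g x → s g (π₂ (π₂ x)) (π₁ (π₂ x)) (π₁ x)) →
  Cmp (λ g x → recℕ (z g x) (s g x) (m g x))
rec-c {m} {z} {s} (cm , pm) (cz , pz) S =
  compᶜ (precᶜ cz (proj₁ S′)) (proj₁ A) , λ g x → _ , proj₂ A g x , correct g x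
  where
  A : Cmp (λ g x → pairℕ x (m g x))
  A = pair-c id-c (cm , pm)
  reorder : ℕ → ℕ
  reorder e = pairℕ (π₂ (π₂ e)) (pairℕ (π₁ (π₂ e)) (π₁ e))
  S″ : Baire → ℕ → ℕ
  S″ g x = s g (π₂ (π₂ x)) (π₁ (π₂ x)) (π₁ x)
  S′ : Cmp (λ g e → S″ g (reorder e))
  S′ = comp-c {f = S″} S (pair-c (π₂-c tail-c) (pair-c (π₁-c tail-c) v0))
  reorder-≡ : ∀ x n a → reorder (pairℕ x (pairℕ n a)) ≡ pairℕ a (pairℕ n x)
  reorder-≡ x n a rewrite unpair-pair x (pairℕ n a) | unpair-pair n a = refl
  S″-≡ : ∀ g x n a → S″ g (pairℕ a (pairℕ n x)) ≡ s g x n a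
  S″-≡ g x n a rewrite unpair-pair a (pairℕ n x) | unpair-pair n x = refl
  step : ∀ g x n a → ⟦ proj₁ S′ ⟧ g (pairℕ x (pairℕ n a)) (s g x n a)
  step g x n a = subst (⟦ proj₁ S′ ⟧ g (pairℕ x (pairℕ n a)))
    (trans (cong (S″ g) (reorder-≡ x n a)) (S″-≡ g x n a)) (proj₂ S′ g (pairℕ x (pairℕ n a)))
  prim : ∀ g x n → PrimRec (⟦ cz ⟧ g) (⟦ proj₁ S′ ⟧ g) x n (recℕ (z g x) (s g x) n)
  prim g x zero    = pz g x
  prim g x (suc n) = _ , prim g x n , step g x n _
  correct : ∀ g x → ⟦ precᶜ cz (proj₁ S′) ⟧ g (pairℕ x (m g x)) (recℕ (z g x) (s g x) (m g x))
  correct g x rewrite unpair-pair x (m g x) = prim g x (m g x)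

module _ {f h : Baire → ℕ → ℕ} where
  +-c : Cmp f → Cmp h → Cmp (λ g x → f g x + h g x)
  +-c F H = let c , p = rec-c {s = λ _ _ _ a → suc a} F H (suc-c v0) in
    c , λ g x → subst (⟦ c ⟧ g x) (rec+ (f g x) (h g x)) (p g x)
    where
    rec+ : ∀ n k → recℕ k (λ _ a → suc a) n ≡ n + k
    rec+ zero    k = refl
    rec+ (suc n) k = cong suc (rec+ n k)

module _ {f h : Baire → ℕ → ℕ} where
  *-c : Cmp f → Cmp h → Cmp (λ g x → f g x * h g x)
  *-c F H = let c , p = rec-c {s = λ g x _ a → h g x + a} F (const-c 0) (+-c (wk (wk H)) v0) in
    c , λ g x → subst (⟦ c ⟧ g x) (rec* (f g x) (h g x)) (p g x)
    where
    rec* : ∀ n k → recℕ 0 (λ _ a → k + a) n ≡ n * k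
    rec* zero    k = refl
    rec* (suc n) k = cong (k +_) (rec* n k)

module _ {f : Baire → ℕ → ℕ} where
  isz-c : Cmp f → Cmp (λ g x → isz (f g x))
  isz-c F = rec-c {s = λ _ _ _ _ → 0} F (const-c 1) (const-c 0)

  prd-c : Cmp f → Cmp (λ g x → prd (f g x))
  prd-c F = rec-c {s = λ _ _ m _ → m} F (const-c 0) v1

module _ {b f h : Baire → ℕ → ℕ} where
  cond-c : Cmp b → Cmp f → Cmp h → Cmp (λ g x → cond (b g x) (f g x) (h g x))
  cond-c B F H = rec-c {s = λ g x _ _ → f g x} B H (wk (wk F))

module _ {f h : Baire → ℕ → ℕ} where
  sub-c : Cmp f → Cmp h → Cmp (λ g x → sub (f g x) (h g x))
  sub-c F H = rec-c {s = λ _ _ _ a → prd a} H F (prd-c v0)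

module _ {f : Baire → ℕ → ℕ} where
  sg-c : Cmp f → Cmp (λ g x → sg (f g x))
  sg-c F = isz-c (isz-c F)

module _ {f h : Baire → ℕ → ℕ} where
  lt-c : Cmp f → Cmp h → Cmp (λ g x → lt (f g x) (h g x))
  lt-c F H = isz-c (sub-c (suc-c F) H)

  eq-c : Cmp f → Cmp h → Cmp (λ g x → eq (f g x) (h g x))
  eq-c F H = isz-c (+-c (sub-c F H) (sub-c H F))

module _ {m : Baire → ℕ → ℕ} {f : Baire → ℕ → ℕ → ℕ} where
  sum-c : Cmp m → Cmp (λ g x → f g (π₂ x) (π₁ x)) → Cmp (λ g x → sum (f g x) (m g x))
  sum-c M F = rec-c {s = λ g x i a → f g x i + a} M (const-c 0) (+-c (wk F) v0)

  ex-c : Cmp m → Cmp (λ g x → f g (π₂ x) (π₁ x)) → Cmp (λ g x → ex (m g x) (f g x))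
  ex-c = sum-c

module _ {m : Baire → ℕ → ℕ} {f : Baire → ℕ → ℕ → ℕ} where
  all-c : Cmp m → Cmp (λ g x → f g (π₂ x) (π₁ x)) → Cmp (λ g x → all (m g x) (f g x))
  all-c M F = isz-c (sum-c {f = λ g x i → isz (f g x i)} M (isz-c F))

-- Coded lists

hd tl : ℕ → ℕ
hd m = π₁ (prd m)
tl m = π₂ (prd m)

dropℕ : ℕ → ℕ → ℕ
dropℕ k m = recℕ m (λ _ → tl) k

-- b is applied to the head and to the code of the tail of a suffix.
someSuffix : (ℕ → ℕ → ℕ) → ℕ → ℕ
someSuffix b m = ex m λ k → sg (dropℕ k m) * b (hd (dropℕ k m)) (tl (dropℕ k m))

opaque
  mem : ℕ → ℕ → ℕ
  mem v = someSuffix λ x _ → eq v x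

SomeSuffix : (ℕ → ℕ → ℕ) → List ℕ → Set
SomeSuffix b []      = ⊥
SomeSuffix b (x ∷ l) = True (b x (codeList l)) ⊎ SomeSuffix b l

tl-∷ : ∀ x m → tl (suc (pairℕ x m)) ≡ m
tl-∷ = π₂-pair

y≤pair : ∀ x y → y ≤ pairℕ x y
y≤pair x y = m≤m+n y _

triangle-mono : ∀ {m n} → m ≤ n → triangle m ≤ triangle n
triangle-mono z≤n     = z≤n
triangle-mono (s≤s h) = s≤s (+-mono-≤ h (triangle-mono h))

n≤triangle : ∀ n → n ≤ triangle n
n≤triangle zero    = z≤n
n≤triangle (suc n) = s≤s (m≤m+n n _)

pair-mono : ∀ {x x′ y y′} → x ≤ x′ → y ≤ y′ → pairℕ x y ≤ pairℕ x′ y′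
pair-mono p q = +-mono-≤ q (triangle-mono (+-mono-≤ q p))

x≤pair : ∀ x y → x ≤ pairℕ x y
x≤pair x y = ≤-trans (≤-trans (m≤n+m x y) (n≤triangle (y + x))) (m≤n+m _ y)

dropℕ-suc : ∀ k m → dropℕ (suc k) m ≡ dropℕ k (tl m)
dropℕ-suc zero    m = refl
dropℕ-suc (suc k) m = cong tl (dropℕ-suc k m)

dropℕ-0 : ∀ k → dropℕ k 0 ≡ 0
dropℕ-0 zero    = refl
dropℕ-0 (suc k) = cong tl (dropℕ-0 k)

module _ (b : ℕ → ℕ → ℕ) where
  private
    body : ℕ → ℕ
    body d = sg d * b (hd d) (tl d)

    body-∷ : ∀ x m → body (suc (pairℕ x m)) ≡ b x m
    body-∷ x m rewrite unpair-pair x m = +-identityʳ _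

    drop-∷ : ∀ k x m → body (dropℕ (suc k) (suc (pairℕ x m))) ≡ body (dropℕ k m)
    drop-∷ k x m = cong body (trans (dropℕ-suc k _) (cong (dropℕ k) (tl-∷ x m)))

    forth : ∀ l k → True (body (dropℕ k (codeList l))) → SomeSuffix b l
    forth []      k       h = contradiction (subst (True ∘ body) (dropℕ-0 k) h) λ ()
    forth (x ∷ l) zero    h = inj₁ (subst True (body-∷ x (codeList l)) h)
    forth (x ∷ l) (suc k) h = inj₂ (forth l k (subst True (drop-∷ k x (codeList l)) h))

    back : ∀ l → SomeSuffix b l → ∃[ k ] k < codeList l × True (body (dropℕ k (codeList l)))
    back (x ∷ l) (inj₁ h) = 0 , z<s , subst True (sym (body-∷ x (codeList l))) h
    -- Prefixing an entry raises the code by at least one, so the code of a list bounds the number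
    -- of entries to drop.
    back (x ∷ l) (inj₂ h) with k , k<l , p ← back l h =
      suc k , s≤s (≤-trans k<l (y≤pair x (codeList l))) , subst True (sym (drop-∷ k x (codeList l))) p

  someSuffix-T : ∀ l → True (someSuffix b (codeList l)) ⇔ SomeSuffix b l
  someSuffix-T l = mk⇔
    (λ h → let k , _ , p = to (ex-T (codeList l) _) h in forth l k p)
    (λ h → from (ex-T (codeList l) _) (back l h))

opaque
  unfolding mem
  mem-T : ∀ v l → True (mem v (codeList l)) ⇔ (v ∈ l)
  mem-T v l = mk⇔ (forth l ∘ to S) (from S ∘ back l)
    where
    S : True (someSuffix (λ x _ → eq v x) (codeList l)) ⇔ SomeSuffix (λ x _ → eq v x) l
    S = someSuffix-T (λ x _ → eq v x) l
    forth : ∀ l → SomeSuffix (λ x _ → eq v x) l → v ∈ l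
    forth (x ∷ l) (inj₁ h) = here (to (eq-T v x) h)
    forth (x ∷ l) (inj₂ h) = there (forth l h)
    back : ∀ l → v ∈ l → SomeSuffix (λ x _ → eq v x) l
    back (x ∷ l) (here h)  = inj₁ (from (eq-T v x) h)
    back (x ∷ l) (there h) = inj₂ (back l h)

-- Certificates are found by a search over numbers; this lets each be read as a list. The code of a
-- tail is smaller, whence the induction on a bound.
codeList-surjective : ∀ m → ∃[ l ] codeList l ≡ m
codeList-surjective m = go m m ≤-refl
  where
  go : ∀ b m → m ≤ b → ∃[ l ] codeList l ≡ m
  go b       zero    _       = [] , refl
  go (suc b) (suc m) (s≤s h)
    with l , e ← go b (π₂ m) (≤-trans (subst (π₂ m ≤_) (pair-unpair m) (y≤pair (π₁ m) (π₂ m))) h) =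
    π₁ m ∷ l , cong suc (trans (cong (pairℕ (π₁ m)) e) (pair-unpair m))

∈⇒≤code : ∀ {v l} → v ∈ l → v ≤ codeList l
∈⇒≤code {l = x ∷ l} (here refl) = m≤n⇒m≤1+n (x≤pair x (codeList l))
∈⇒≤code {l = x ∷ l} (there h)   = m≤n⇒m≤1+n (≤-trans (∈⇒≤code h) (y≤pair x (codeList l)))

-- The diagonal construction

-- cap n exceeds the codes of the strings pre x n with x below base; it bounds both the number of
-- guards for n and the number of values killed at n.  The union bound needs base n to exceed
-- (1 + base q) * cap n for all q < n.
bse : ℕ → ℕ
bse a = suc (suc a * a)

cap base base′ : ℕ → ℕ
cap n = recℕ 1 (λ n a → suc (suc (pairℕ (pairℕ n (bse a)) a))) n
base n = bse (cap n)
base′ n = suc (cap n) * cap n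

-- Strings are lists of pairs of a position and a value, newest entry first, so that an oracle query
-- becomes a membership test.
snoc : ℕ → ℕ → ℕ → ℕ
snoc n a σ = suc (pairℕ (pairℕ n a) σ)

-- ev σ c x y: the program c with the finite string σ as oracle maps x to y.
-- bg q v n σ: there is a tree for the output v at q above the string σ of length n.
opaque
  ev bg : ℕ → ℕ → ℕ → ℕ → ℕ
  ev σ c x y = pairℕ 0 (pairℕ σ (pairℕ c (pairℕ x y)))
  bg q v n σ = pairℕ 1 (pairℕ q (pairℕ v (pairℕ n σ)))

-- The letters stand for pairing, composition, recursion and minimisation; `R` codes the list of
-- facts that may serve as premises.
ruleP ruleC ruleR ruleM : (σ b x y R : ℕ) → ℕ
ruleP σ b x y R = mem (ev σ (π₁ b) x (π₁ y)) R * mem (ev σ (π₂ b) x (π₂ y)) R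
ruleC σ b x y R = ex R λ z → mem (ev σ (π₂ b) x z) R * mem (ev σ (π₁ b) z y) R
ruleR σ b x y R = cond (π₂ x)
  (ex R λ z → mem (ev σ (pairℕ 7 b) (pairℕ (π₁ x) (prd (π₂ x))) z) R
            * mem (ev σ (π₂ b) (pairℕ (π₁ x) (pairℕ (prd (π₂ x)) z)) y) R)
  (mem (ev σ (π₁ b) (π₁ x) y) R)
ruleM σ b x y R = mem (ev σ b (pairℕ x y) 0) R
  * all y λ m → ex R λ k → mem (ev σ b (pairℕ x m) (suc k)) R

evJ : (σ t b x y R : ℕ) → ℕ
evJ σ t b x y R =
  cond (eq t 0) (eq y 0)
  (cond (eq t 1) (eq y (suc x))
  (cond (eq t 2) (eq y (π₁ x))
  (cond (eq t 3) (eq y (π₂ x))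
  (cond (eq t 4) (mem (pairℕ x y) σ)
  (cond (eq t 5) (ruleP σ b x y R)
  (cond (eq t 6) (ruleC σ b x y R)
  (cond (eq t 7) (ruleR σ b x y R)
  (ruleM σ b x y R))))))))

-- At a leaf the program already outputs `v`. At an inner node more than `cap n` children must carry
-- a tree, so that the values killed at `n` cannot cover them.
bgJ : (q v n σ R : ℕ) → ℕ
bgJ q v n σ R = mem (ev σ (π₂ q) q v) R
  + lt (cap n) (sum (λ a → sg (mem (bg q v (suc n) (snoc n a σ)) R)) (base n))

justE justB just : ℕ → ℕ → ℕ
justE u R = evJ (π₁ u) (π₁ (π₁ (π₂ u))) (π₂ (π₁ (π₂ u))) (π₁ (π₂ (π₂ u))) (π₂ (π₂ (π₂ u))) R
justB u R = bgJ (π₁ u) (π₁ (π₂ u)) (π₁ (π₂ (π₂ u))) (π₂ (π₂ (π₂ u))) R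
just f R = cond (π₁ f) (justB (π₂ f) R) (justE (π₂ f) R)

opaque
  -- Each entry is to be justified by the entries after it, which rules out circular justifications.
  valid : ℕ → ℕ
  valid m = isz (someSuffix (λ f R → isz (just f R)) m)

-- The guard ρ is a string of length q; the entry 0 is appended to it.
opaque
  cert first : ℕ → ℕ → ℕ → ℕ
  cert q ρ s = valid (π₂ s) * mem (bg q (π₁ s) (suc q) (snoc q 0 ρ)) (π₂ s)
  first q ρ s = cert q ρ s * all s λ s′ → isz (cert q ρ s′)

  cert-T : ∀ q ρ s → True (cert q ρ s) ⇔
    (True (valid (π₂ s)) × True (mem (bg q (π₁ s) (suc q) (snoc q 0 ρ)) (π₂ s)))
  cert-T q ρ s = *-T (valid (π₂ s)) (mem (bg q (π₁ s) (suc q) (snoc q 0 ρ)) (π₂ s))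

opaque
  unfolding first
  first-T : ∀ q ρ s → True (first q ρ s) ⇔ (True (cert q ρ s) × (∀ k → k < s → ¬ True (cert q ρ k)))
  first-T q ρ s = mk⇔
    (λ h → let p , b = to T h in p , λ k k<s →
      to (isz-T (cert q ρ k)) (to A b k k<s))
    (λ (p , b) → from T (p , from A λ k k<s →
      from (isz-T (cert q ρ k)) (b k k<s)))
    where
    T : True (first q ρ s) ⇔ (True (cert q ρ s) × True (all s λ k → isz (cert q ρ k)))
    T = *-T (cert q ρ s) (all s λ k → isz (cert q ρ k))
    A : True (all s λ k → isz (cert q ρ k)) ⇔ (∀ k → k < s → True (isz (cert q ρ k)))
    A = all-T s λ k → isz (cert q ρ k)

-- Programs for the certificate predicates

private variable
  f₁ f₂ f₃ f₄ f₅ f₆ : Baire → ℕ → ℕ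

hd-c : Cmp f₁ → Cmp (λ g x → hd (f₁ g x))
hd-c F = π₁-c (prd-c F)

tl-c : Cmp f₁ → Cmp (λ g x → tl (f₁ g x))
tl-c F = π₂-c (prd-c F)

drop-c : Cmp f₁ → Cmp f₂ → Cmp (λ g x → dropℕ (f₁ g x) (f₂ g x))
drop-c K M = rec-c {s = λ _ _ _ → tl} K M (tl-c v0)

opaque
  unfolding mem
  mem-c : Cmp f₁ → Cmp f₂ → Cmp (λ g x → mem (f₁ g x) (f₂ g x))
  mem-c {f₁} {f₂} V M = ex-c
    {f = λ g x k → sg (dropℕ k (f₂ g x)) * eq (f₁ g x) (hd (dropℕ k (f₂ g x)))} M
    (*-c (sg-c D) (eq-c (wk V) (hd-c D)))
    where
    D : Cmp (λ g x → dropℕ (π₁ x) (f₂ g (π₂ x)))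
    D = drop-c v0 (wk M)

bse-c : Cmp f₁ → Cmp (λ g x → bse (f₁ g x))
bse-c F = suc-c (*-c (suc-c F) F)

cap-c : Cmp f₁ → Cmp (λ g x → cap (f₁ g x))
cap-c F = rec-c {s = λ _ _ n a → suc (suc (pairℕ (pairℕ n (bse a)) a))} F (const-c 1)
  (suc-c (suc-c (pair-c (pair-c v1 (bse-c v0)) v0)))

base-c : Cmp f₁ → Cmp (λ g x → base (f₁ g x))
base-c F = bse-c (cap-c F)

base′-c : Cmp f₁ → Cmp (λ g x → base′ (f₁ g x))
base′-c F = *-c (suc-c (cap-c F)) (cap-c F)

snoc-c : Cmp f₁ → Cmp f₂ → Cmp f₃ → Cmp (λ g x → snoc (f₁ g x) (f₂ g x) (f₃ g x))
snoc-c N A S = suc-c (pair-c (pair-c N A) S)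

opaque
  unfolding ev
  ev-c : Cmp f₁ → Cmp f₂ → Cmp f₃ → Cmp f₄ → Cmp (λ g x → ev (f₁ g x) (f₂ g x) (f₃ g x) (f₄ g x))
  ev-c S C X Y = pair-c (const-c 0) (pair-c S (pair-c C (pair-c X Y)))

  bg-c : Cmp f₁ → Cmp f₂ → Cmp f₃ → Cmp f₄ → Cmp (λ g x → bg (f₁ g x) (f₂ g x) (f₃ g x) (f₄ g x))
  bg-c Q V N S = pair-c (const-c 1) (pair-c Q (pair-c V (pair-c N S)))

module _ (S : Cmp f₁) (B : Cmp f₂) (X : Cmp f₃) (Y : Cmp f₄) (R : Cmp f₅) where
  ruleP-c : Cmp (λ g x → ruleP (f₁ g x) (f₂ g x) (f₃ g x) (f₄ g x) (f₅ g x))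
  ruleP-c = *-c (mem-c (ev-c S (π₁-c B) X (π₁-c Y)) R) (mem-c (ev-c S (π₂-c B) X (π₂-c Y)) R)

  ruleC-c : Cmp (λ g x → ruleC (f₁ g x) (f₂ g x) (f₃ g x) (f₄ g x) (f₅ g x))
  ruleC-c = ex-c {f = λ g x z → mem (ev (f₁ g x) (π₂ (f₂ g x)) (f₃ g x) z) (f₅ g x)
                              * mem (ev (f₁ g x) (π₁ (f₂ g x)) z (f₄ g x)) (f₅ g x)} R
    (*-c (mem-c (ev-c (wk S) (π₂-c (wk B)) (wk X) v0) (wk R))
         (mem-c (ev-c (wk S) (π₁-c (wk B)) v0 (wk Y)) (wk R)))

  ruleR-c : Cmp (λ g x → ruleR (f₁ g x) (f₂ g x) (f₃ g x) (f₄ g x) (f₅ g x))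
  ruleR-c = cond-c (π₂-c X)
    (ex-c {f = λ g x z →
        mem (ev (f₁ g x) (pairℕ 7 (f₂ g x)) (pairℕ (π₁ (f₃ g x)) (prd (π₂ (f₃ g x)))) z) (f₅ g x)
      * mem (ev (f₁ g x) (π₂ (f₂ g x)) (pairℕ (π₁ (f₃ g x)) (pairℕ (prd (π₂ (f₃ g x))) z)) (f₄ g x)) (f₅ g x)} R
      (*-c (mem-c (ev-c (wk S) (pair-c (const-c 7) (wk B)) (pair-c A N) v0) (wk R))
           (mem-c (ev-c (wk S) (π₂-c (wk B)) (pair-c A (pair-c N v0)) (wk Y)) (wk R))))
    (mem-c (ev-c S (π₁-c B) (π₁-c X) Y) R)
    where
    A : Cmp (λ g x → π₁ (f₃ g (π₂ x)))
    A = π₁-c (wk X)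
    N : Cmp (λ g x → prd (π₂ (f₃ g (π₂ x))))
    N = prd-c (π₂-c (wk X))

  ruleM-c : Cmp (λ g x → ruleM (f₁ g x) (f₂ g x) (f₃ g x) (f₄ g x) (f₅ g x))
  ruleM-c = *-c (mem-c (ev-c S B (pair-c X Y) (const-c 0)) R)
    (all-c {f = λ g x m → ex (f₅ g x) λ k → mem (ev (f₁ g x) (f₂ g x) (pairℕ (f₃ g x) m) (suc k)) (f₅ g x)} Y
      (ex-c {f = λ g x k → mem (ev (f₁ g (π₂ x)) (f₂ g (π₂ x)) (pairℕ (f₃ g (π₂ x)) (π₁ x)) (suc k)) (f₅ g (π₂ x))}
        (wk R)
        (mem-c (ev-c (wk (wk S)) (wk (wk B)) (pair-c (wk (wk X)) v1) (suc-c v0)) (wk (wk R)))))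

evJ-c : Cmp f₁ → Cmp f₂ → Cmp f₃ → Cmp f₄ → Cmp f₅ → Cmp f₆ →
  Cmp (λ g x → evJ (f₁ g x) (f₂ g x) (f₃ g x) (f₄ g x) (f₅ g x) (f₆ g x))
evJ-c S T B X Y R =
  cond-c (eq-c T (const-c 0)) (eq-c Y (const-c 0))
  (cond-c (eq-c T (const-c 1)) (eq-c Y (suc-c X))
  (cond-c (eq-c T (const-c 2)) (eq-c Y (π₁-c X))
  (cond-c (eq-c T (const-c 3)) (eq-c Y (π₂-c X))
  (cond-c (eq-c T (const-c 4)) (mem-c (pair-c X Y) S)
  (cond-c (eq-c T (const-c 5)) (ruleP-c S B X Y R)
  (cond-c (eq-c T (const-c 6)) (ruleC-c S B X Y R)
  (cond-c (eq-c T (const-c 7)) (ruleR-c S B X Y R)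
  (ruleM-c S B X Y R))))))))

bgJ-c : Cmp f₁ → Cmp f₂ → Cmp f₃ → Cmp f₄ → Cmp f₅ →
  Cmp (λ g x → bgJ (f₁ g x) (f₂ g x) (f₃ g x) (f₄ g x) (f₅ g x))
bgJ-c {f₁} {f₂} {f₃} {f₄} {f₅} Q V N S R = +-c (mem-c (ev-c S (π₂-c Q) Q V) R)
  (lt-c (cap-c N)
    (sum-c {f = λ g x a → sg (mem (bg (f₁ g x) (f₂ g x) (suc (f₃ g x)) (snoc (f₃ g x) a (f₄ g x))) (f₅ g x))}
      (base-c N)
      (sg-c (mem-c (bg-c (wk Q) (wk V) (suc-c (wk N)) (snoc-c (wk N) v0 (wk S))) (wk R)))))

just-c : Cmp f₁ → Cmp f₂ → Cmp (λ g x → just (f₁ g x) (f₂ g x))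
just-c F R = cond-c (π₁-c F)
  (bgJ-c (π₁-c U) (π₁-c (π₂-c U)) (π₁-c (π₂-c (π₂-c U))) (π₂-c (π₂-c (π₂-c U))) R)
  (evJ-c (π₁-c U) (π₁-c (π₁-c (π₂-c U))) (π₂-c (π₁-c (π₂-c U)))
    (π₁-c (π₂-c (π₂-c U))) (π₂-c (π₂-c (π₂-c U))) R)
  where U = π₂-c F

opaque
  unfolding valid
  valid-c : Cmp f₁ → Cmp (λ g x → valid (f₁ g x))
  valid-c {f₁} M = isz-c (ex-c
    {f = λ g x k → sg (dropℕ k (f₁ g x)) * isz (just (hd (dropℕ k (f₁ g x))) (tl (dropℕ k (f₁ g x))))} M
    (*-c (sg-c D) (isz-c (just-c (hd-c D) (tl-c D)))))
    where
    D : Cmp (λ g x → dropℕ (π₁ x) (f₁ g (π₂ x)))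
    D = drop-c v0 (wk M)

opaque
  unfolding first
  cert-c : Cmp f₁ → Cmp f₂ → Cmp f₃ → Cmp (λ g x → cert (f₁ g x) (f₂ g x) (f₃ g x))
  cert-c Q P S = *-c (valid-c (π₂-c S))
    (mem-c (bg-c Q (π₁-c S) (suc-c Q) (snoc-c Q (const-c 0) P)) (π₂-c S))

  first-c : Cmp f₁ → Cmp f₂ → Cmp f₃ → Cmp (λ g x → first (f₁ g x) (f₂ g x) (f₃ g x))
  first-c {f₁} {f₂} Q P S = *-c (cert-c Q P S)
    (all-c {f = λ g x s → isz (cert (f₁ g x) (f₂ g x) s)} S (isz-c (cert-c (wk Q) (wk P) v0)))

-- Facts and their derivations

data Fact : Set where
  evᶠ : (σ : List ℕ) (c : Code) (x y : ℕ) → Fact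
  bgᶠ : (i : ℕ) (c : Code) (v n : ℕ) (σ : List ℕ) → Fact

code : Fact → ℕ
code (evᶠ σ c x y)   = ev (codeList σ) ⌜ c ⌝ x y
code (bgᶠ i c v n σ) = bg (pairℕ i ⌜ c ⌝) v n (codeList σ)

-- J f M: the fact f follows by one rule from facts in M.
J : Fact → (Fact → Set) → Set
J (evᶠ σ zeroᶜ x y)       M = y ≡ 0
J (evᶠ σ succᶜ x y)       M = y ≡ suc x
J (evᶠ σ leftᶜ x y)       M = y ≡ π₁ x
J (evᶠ σ rightᶜ x y)      M = y ≡ π₂ x
J (evᶠ σ oracleᶜ x y)     M = pairℕ x y ∈ σ
J (evᶠ σ (pairᶜ c d) x y) M = M (evᶠ σ c x (π₁ y)) × M (evᶠ σ d x (π₂ y))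
J (evᶠ σ (compᶜ c d) x y) M = ∃[ z ] M (evᶠ σ d x z) × M (evᶠ σ c z y)
J (evᶠ σ (precᶜ c d) x y) M =
    (π₂ x ≡ 0 × M (evᶠ σ c (π₁ x) y))
  ⊎ (∃[ n ] ∃[ z ] π₂ x ≡ suc n × M (evᶠ σ (precᶜ c d) (pairℕ (π₁ x) n) z)
                   × M (evᶠ σ d (pairℕ (π₁ x) (pairℕ n z)) y))
J (evᶠ σ (rfindᶜ c) x y)  M =
  M (evᶠ σ c (pairℕ x y) 0) × (∀ m → m < y → ∃[ k ] M (evᶠ σ c (pairℕ x m) (suc k)))
J (bgᶠ i c v n σ)         M =
    M (evᶠ σ c (pairℕ i ⌜ c ⌝) v)
  ⊎ (∃[ χ ] cap n < sum (sg ∘ χ) (base n)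
          × (∀ a → a < base n → True (χ a) → M (bgᶠ i c v (suc n) (pairℕ n a ∷ σ))))

-- The branching clause is monotone because `χ` only marks some children lying in `M`, and enlarging
-- `M` leaves these marks correct.
J-mono : ∀ f {M N} → (∀ {g} → M g → N g) → J f M → J f N
J-mono (evᶠ σ zeroᶜ x y)       s h = h
J-mono (evᶠ σ succᶜ x y)       s h = h
J-mono (evᶠ σ leftᶜ x y)       s h = h
J-mono (evᶠ σ rightᶜ x y)      s h = h
J-mono (evᶠ σ oracleᶜ x y)     s h = h
J-mono (evᶠ σ (pairᶜ c d) x y) s (p , q) = s p , s q
J-mono (evᶠ σ (compᶜ c d) x y) s (z , p , q) = z , s p , s q
J-mono (evᶠ σ (precᶜ c d) x y) s (inj₁ (e , p)) = inj₁ (e , s p)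
J-mono (evᶠ σ (precᶜ c d) x y) s (inj₂ (n , z , e , p , q)) = inj₂ (n , z , e , s p , s q)
J-mono (evᶠ σ (rfindᶜ c) x y)  s (p , q) = s p , λ m m<y → let k , r = q m m<y in k , s r
J-mono (bgᶠ i c v n σ)         s (inj₁ p) = inj₁ (s p)
J-mono (bgᶠ i c v n σ)         s (inj₂ (χ , p , q)) = inj₂ (χ , p , λ a a<b t → s (q a a<b t))

opaque
  unfolding ev
  just-ev : ∀ σ c x y R → just (ev σ c x y) R ≡ evJ σ (π₁ c) (π₂ c) x y R
  just-ev σ c x y R
    rewrite unpair-pair 0 (pairℕ σ (pairℕ c (pairℕ x y)))
          | unpair-pair σ (pairℕ c (pairℕ x y)) | unpair-pair c (pairℕ x y) | unpair-pair x y = refl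

  just-bg : ∀ q v n σ R → just (bg q v n σ) R ≡ bgJ q v n σ R
  just-bg q v n σ R
    rewrite unpair-pair 1 (pairℕ q (pairℕ v (pairℕ n σ)))
          | unpair-pair q (pairℕ v (pairℕ n σ)) | unpair-pair v (pairℕ n σ) | unpair-pair n σ = refl

sum-mono : ∀ {f h : ℕ → ℕ} n → (∀ a → a < n → f a ≤ h a) → sum f n ≤ sum h n
sum-mono zero    p = z≤n
sum-mono (suc n) p = +-mono-≤ (p n ≤-refl) (sum-mono n λ a a<n → p a (m<n⇒m<1+n a<n))

opaque
  unfolding ev
  output≤ev : ∀ σ c x y → y ≤ ev σ c x y
  output≤ev σ c x y = ≤-trans (y≤pair x y) (≤-trans (y≤pair c (pairℕ x y))
    (≤-trans (y≤pair σ (pairℕ c (pairℕ x y))) (y≤pair 0 (pairℕ σ (pairℕ c (pairℕ x y))))))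

module _ (r : List ℕ) where
  private
    R = codeList r
    M : Fact → Set
    M f = code f ∈ r

    evJ-tag : ∀ σ t b x y {S : Set} → True (evJ σ t b x y R) ⇔ S →
      True (just (ev σ (pairℕ t b) x y) R) ⇔ S
    evJ-tag σ t b x y h = mk⇔
      (λ p → to h (subst True eq′ p)) (λ s → subst True (sym eq′) (from h s))
      where
      eq′ : just (ev σ (pairℕ t b) x y) R ≡ evJ σ t b x y R
      eq′ rewrite just-ev σ (pairℕ t b) x y R | unpair-pair t b = refl

    pairT : ∀ u v → True (mem u R * mem v R) ⇔ (u ∈ r × v ∈ r)
    pairT u v = mk⇔
      (λ h → let p , q = to (*-T (mem u R) (mem v R)) h in to (mem-T u r) p , to (mem-T v r) q)
      (λ (p , q) → from (*-T (mem u R) (mem v R)) (from (mem-T u r) p , from (mem-T v r) q))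

    -- Elements of a list are at most its code, so bounding searches by the code loses nothing.
    bound : ∀ {w z l} → z ≤ w → w ∈ l → z < codeList l
    bound {w} {z} {_ ∷ l} z≤w (here refl) = s≤s (≤-trans z≤w (x≤pair w (codeList l)))
    bound {w} {z} {u ∷ l} z≤w (there h)   =
      s≤s (≤-trans (n≤1+n z) (≤-trans (bound z≤w h) (y≤pair u (codeList l))))

  -- The existential searches in the numerical check stop below `R`, which is far enough: no number
  -- sought exceeds the output of some listed fact.
  just-T : ∀ f → True (just (code f) R) ⇔ J f M
  just-T (evᶠ σ zeroᶜ x y)   = evJ-tag (codeList σ) 0 0 x y (eq-T y 0)
  just-T (evᶠ σ succᶜ x y)   = evJ-tag (codeList σ) 1 0 x y (eq-T y (suc x))
  just-T (evᶠ σ leftᶜ x y)   = evJ-tag (codeList σ) 2 0 x y (eq-T y (π₁ x))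
  just-T (evᶠ σ rightᶜ x y)  = evJ-tag (codeList σ) 3 0 x y (eq-T y (π₂ x))
  just-T (evᶠ σ oracleᶜ x y) = evJ-tag (codeList σ) 4 0 x y (mem-T (pairℕ x y) σ)
  just-T (evᶠ σ (pairᶜ c d) x y) = evJ-tag s 5 (pairℕ ⌜ c ⌝ ⌜ d ⌝) x y rule
    where
    s = codeList σ
    rule : True (ruleP s (pairℕ ⌜ c ⌝ ⌜ d ⌝) x y R) ⇔ J (evᶠ σ (pairᶜ c d) x y) M
    rule rewrite unpair-pair ⌜ c ⌝ ⌜ d ⌝ = pairT _ _
  just-T (evᶠ σ (compᶜ c d) x y) = evJ-tag s 6 (pairℕ ⌜ c ⌝ ⌜ d ⌝) x y rule
    where
    s = codeList σ
    rule : True (ruleC s (pairℕ ⌜ c ⌝ ⌜ d ⌝) x y R) ⇔ J (evᶠ σ (compᶜ c d) x y) M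
    rule rewrite unpair-pair ⌜ c ⌝ ⌜ d ⌝ = mk⇔
      (λ h → let z , _ , p = to (ex-T R _) h in z , to (pairT _ _) p)
      (λ (z , p , q) → from (ex-T R _) (z , bound (output≤ev _ _ _ z) p , from (pairT _ _) (p , q)))
  just-T (evᶠ σ (precᶜ c d) x y) = evJ-tag s 7 (pairℕ ⌜ c ⌝ ⌜ d ⌝) x y rule
    where
    s = codeList σ
    b = pairℕ ⌜ c ⌝ ⌜ d ⌝
    step : ℕ → ℕ → ℕ
    step n z = mem (ev s (pairℕ 7 b) (pairℕ (π₁ x) n) z) R
             * mem (ev s ⌜ d ⌝ (pairℕ (π₁ x) (pairℕ n z)) y) R
    cases : ∀ m → True (cond m (ex R (step (prd m))) (mem (ev s ⌜ c ⌝ (π₁ x) y) R))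
      ⇔ ((m ≡ 0 × M (evᶠ σ c (π₁ x) y))
        ⊎ (∃[ n ] ∃[ z ] m ≡ suc n × M (evᶠ σ (precᶜ c d) (pairℕ (π₁ x) n) z)
                   × M (evᶠ σ d (pairℕ (π₁ x) (pairℕ n z)) y)))
    cases zero    = mk⇔ (λ h → inj₁ (refl , to (mem-T _ r) h))
      λ { (inj₁ (_ , h)) → from (mem-T _ r) h ; (inj₂ (_ , _ , () , _)) }
    cases (suc n) = mk⇔
      (λ h → let z , _ , p = to (ex-T R (step n)) h in inj₂ (n , z , refl , to (pairT _ _) p))
      λ { (inj₁ (() , _))
        ; (inj₂ (_ , z , refl , p , q)) → from (ex-T R (step n)) (z , bound (output≤ev _ _ _ z) p , from (pairT _ _) (p , q)) }
    rule : True (ruleR s b x y R) ⇔ J (evᶠ σ (precᶜ c d) x y) M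
    rule rewrite unpair-pair ⌜ c ⌝ ⌜ d ⌝ = cases (π₂ x)
  just-T (evᶠ σ (rfindᶜ c) x y)  = evJ-tag s 8 ⌜ c ⌝ x y (mk⇔
      (λ h → let p , q = to T h in to (mem-T _ r) p , λ m m<y →
        let k , _ , w = to (ex-T R (A m)) (to (all-T y (ex R ∘ A)) q m m<y) in k , to (mem-T _ r) w)
      (λ (p , q) → from T (from (mem-T _ r) p , from (all-T y (ex R ∘ A)) λ m m<y → search m (q m m<y))))
    where
    s = codeList σ
    A : ℕ → ℕ → ℕ
    A m k = mem (ev s ⌜ c ⌝ (pairℕ x m) (suc k)) R
    T = *-T (mem (ev s ⌜ c ⌝ (pairℕ x y) 0) R) (all y (ex R ∘ A))
    search : ∀ m → ∃[ k ] M (evᶠ σ c (pairℕ x m) (suc k)) → True (ex R (A m))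
    search m (k , w) = from (ex-T R (A m))
      (k , <-trans ≤-refl (bound (output≤ev s ⌜ c ⌝ (pairℕ x m) (suc k)) w) , from (mem-T _ r) w)
  just-T (bgᶠ i c v n σ) = rule′
    where
    s = codeList σ
    q = pairℕ i ⌜ c ⌝
    χ : ℕ → ℕ
    χ a = mem (bg q v (suc n) (snoc n a s)) R
    A = mem (ev s ⌜ c ⌝ q v) R
    B = lt (cap n) (sum (sg ∘ χ) (base n))
    rule : True (A + B) ⇔ J (bgᶠ i c v n σ) M
    rule = mk⇔
      (λ h → [ inj₁ ∘ to (mem-T _ r)
             , (λ p → inj₂ (χ , to (lt-T (cap n) _) p , λ a _ → to (mem-T _ r))) ]′ (to (+-T A B) h))
      λ { (inj₁ h) → from (+-T A B) (inj₁ (from (mem-T _ r) h))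
        ; (inj₂ (χ′ , p , w)) → from (+-T A B) (inj₂ (from (lt-T (cap n) _)
            (≤-trans p (sum-mono (base n) (λ a a<b → le χ′ w a a<b))))) }
      where
      -- A marking of some children is dominated by the full membership test, so its count is a
      -- lower bound.
      le : ∀ (χ′ : ℕ → ℕ) → (∀ a → a < base n → True (χ′ a) → M (bgᶠ i c v (suc n) (pairℕ n a ∷ σ))) →
        ∀ a → a < base n → sg (χ′ a) ≤ sg (χ a)
      le χ′ w a a<b with True? (χ′ a)
      ... | yes t = ≤-trans (sg≤1 (χ′ a)) (from (sg-T (χ a)) (from (mem-T _ r) (w a a<b t)))
      ... | no ¬t = subst (λ k → sg k ≤ sg (χ a)) (sym (¬True⇒≡0 ¬t)) z≤n
    eq′ : just (bg q v n s) R ≡ A + B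
    eq′ rewrite just-bg q v n s R = cong (λ k → mem (ev s k q v) R + B) (π₂-pair i ⌜ c ⌝)
    rule′ : True (just (bg q v n s) R) ⇔ J (bgᶠ i c v n σ) M
    rule′ rewrite eq′ = rule

Valid : List ℕ → Set
Valid []      = ⊤
Valid (w ∷ r) = True (just w (codeList r)) × Valid r

opaque
  unfolding valid
  valid-T : ∀ l → True (valid (codeList l)) ⇔ Valid l
  valid-T l = mk⇔
    (λ h → good l (to (isz-T _) h ∘ from (someSuffix-T B l)))
    (λ h → from (isz-T _) (bad l h ∘ to (someSuffix-T B l)))
    where
    B : ℕ → ℕ → ℕ
    B f R = isz (just f R)
    good : ∀ l → ¬ SomeSuffix B l → Valid l
    good []      h = tt
    good (w ∷ l) h = p , good l (h ∘ inj₂)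
      where
      p : True (just w (codeList l))
      p with True? (just w (codeList l))
      ... | yes t = t
      ... | no ¬t = contradiction (inj₁ (from (isz-T _) ¬t)) h
    bad : ∀ l → Valid l → ¬ SomeSuffix B l
    bad (w ∷ l) (p , _) (inj₁ h) = to (isz-T _) h p
    bad (w ∷ l) (_ , v) (inj₂ h) = bad l v h

Valid⇒J : ∀ {l} → Valid l → ∀ f → code f ∈ l → J f (λ g → code g ∈ l)
Valid⇒J {w ∷ l} (p , _) f (here refl) = J-mono f there (to (just-T l f) p)
Valid⇒J {w ∷ l} (_ , v) f (there h)   = J-mono f there (Valid⇒J v f h)

-- Derivations assembled by hand consist of facts, whereas a search over numbers may meet entries
-- that code no fact.
Validᶠ : List Fact → Set
Validᶠ []      = ⊤
Validᶠ (f ∷ r) = J f (_∈ r) × Validᶠ r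

Validᶠ⇒Valid : ∀ {l} → Validᶠ l → Valid (map code l)
Validᶠ⇒Valid {[]}    _       = tt
Validᶠ⇒Valid {f ∷ l} (p , v) =
  from (just-T (map code l) f) (J-mono f (∈-map⁺ code) p) , Validᶠ⇒Valid v

++-Validᶠ : ∀ l {m} → Validᶠ l → Validᶠ m → Validᶠ (l ++ m)
++-Validᶠ []      _       w = w
++-Validᶠ (f ∷ l) (p , v) w = J-mono f ∈-++⁺ˡ p , ++-Validᶠ l v w

Derivation : (List Fact → Set) → Set
Derivation P = ∃[ l ] Validᶠ l × P l

Der : Fact → Set
Der f = Derivation (f ∈_)

both : ∀ {P Q : List Fact → Set} → (∀ {l m} → P l → P (l ++ m)) → (∀ {l m} → Q m → Q (l ++ m)) →
  Derivation P → Derivation Q → Derivation (λ l → P l × Q l)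
both P⁺ Q⁺ (l , v , p) (m , w , q) = l ++ m , ++-Validᶠ l v w , P⁺ p , Q⁺ q

both-∈ : ∀ {f g} → Der f → Der g → Derivation (λ l → f ∈ l × g ∈ l)
both-∈ = both ∈-++⁺ˡ (∈-++⁺ʳ _)

derive : ∀ {P : List Fact → Set} f → Derivation P → (∀ {l} → P l → J f (_∈ l)) → Der f
derive f (l , v , p) j = f ∷ l , (j p , v) , here refl

axiom : ∀ f → J f (_∈ []) → Der f
axiom f j = f ∷ [] , (j , tt) , here refl

collect : ∀ {P : ℕ → List Fact → Set} → (∀ {m l l′} → (∀ {f} → f ∈ l → f ∈ l′) → P m l → P m l′) →
  ∀ n → (∀ m → m < n → Derivation (P m)) → Derivation (λ l → ∀ m → m < n → P m l)
collect P⁺ zero    h = [] , tt , λ m ()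
collect {P} P⁺ (suc n) h
  with l , v , p , q ← both {P n} (P⁺ ∈-++⁺ˡ) (λ q m m<n → P⁺ (∈-++⁺ʳ _) (q m m<n))
         (h n ≤-refl) (collect P⁺ n (λ m m<n → h m (m<n⇒m<1+n m<n))) =
  l , v , split
  where
  split : ∀ m → m < suc n → P m l
  split m m<1+n with m<1+n⇒m<n∨m≡n m<1+n
  ... | inj₁ m<n  = q m m<n
  ... | inj₂ refl = p

-- Finite parts of oracles

pre : Baire → ℕ → List ℕ
pre x zero    = []
pre x (suc n) = pairℕ n (x n) ∷ pre x n

pre-cong : ∀ {x y} n → (∀ j → j < n → x j ≡ y j) → pre x n ≡ pre y n
pre-cong zero    h = refl
pre-cong (suc n) h = cong₂ (λ a σ → pairℕ n a ∷ σ) (h n ≤-refl)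
  (pre-cong n λ j j<n → h j (m<n⇒m<1+n j<n))

_extends_ : Baire → List ℕ → Set
g extends σ = ∀ j a → pairℕ j a ∈ σ → g j ≡ a

∈-pre : ∀ {g} j n → j < n → pairℕ j (g j) ∈ pre g n
∈-pre j (suc n) j<1+n with m<1+n⇒m<n∨m≡n j<1+n
... | inj₁ j<n  = there (∈-pre j n j<n)
... | inj₂ refl = here refl

extends-pre : ∀ {g x} n → (∀ j → j < n → g j ≡ x j) → g extends pre x n
extends-pre {x = x} (suc n) h j a (here e)  =
  trans (cong _ j≡n) (trans (h n ≤-refl) (trans (sym (π₂-pair n (x n))) (trans (cong π₂ (sym e)) (π₂-pair j a))))
  where
  j≡n : j ≡ n
  j≡n = trans (sym (π₁-pair j a)) (trans (cong π₁ e) (π₁-pair n (x n)))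
extends-pre (suc n) h j a (there p) = extends-pre n (λ j j<n → h j (m<n⇒m<1+n j<n)) j a p

module _ {l σ g} (v : Valid l) (ext : g extends σ) where
  -- Induction on the program. A premise for `precᶜ` concerns the same program, so there an inner
  -- induction on the recursion argument takes over.
  ev-sound : ∀ c {x y} → code (evᶠ σ c x y) ∈ l → ⟦ c ⟧ g x y
  ev-sound c {x} {y} p = go c x y (Valid⇒J v (evᶠ σ c x y) p)
    where
    go : ∀ c x y → J (evᶠ σ c x y) (λ f → code f ∈ l) → ⟦ c ⟧ g x y
    go zeroᶜ       x y e       = e
    go succᶜ       x y e       = e
    go leftᶜ       x y e       = e
    go rightᶜ      x y e       = e
    go oracleᶜ     x y e       = sym (ext x y e)
    go (pairᶜ c d) x y (p , q) = π₁ y , π₂ y ,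
      go c x (π₁ y) (Valid⇒J v _ p) , go d x (π₂ y) (Valid⇒J v _ q) , sym (pair-unpair y)
    go (compᶜ c d) x y (z , p , q) = z , go d x z (Valid⇒J v _ p) , go c z y (Valid⇒J v _ q)
    go (precᶜ c d) x y h       = rec (π₂ x) x y refl h
      where
      rec : ∀ n x y → π₂ x ≡ n → J (evᶠ σ (precᶜ c d) x y) (λ f → code f ∈ l) →
        PrimRec (⟦ c ⟧ g) (⟦ d ⟧ g) (π₁ x) n y
      rec n x y e (inj₁ (e′ , p)) with refl ← trans (sym e) e′ = go c (π₁ x) y (Valid⇒J v _ p)
      rec n x y e (inj₂ (m , z , e′ , p , q)) with refl ← trans (sym e) e′ = z ,
        subst (λ a → PrimRec (⟦ c ⟧ g) (⟦ d ⟧ g) a m z) (π₁-pair (π₁ x) m)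
          (rec m (pairℕ (π₁ x) m) z (π₂-pair (π₁ x) m)
            (Valid⇒J v (evᶠ σ (precᶜ c d) (pairℕ (π₁ x) m) z) p)) ,
        go d _ y (Valid⇒J v _ q)
    go (rfindᶜ c) x y (p , q) = go c (pairℕ x y) 0 (Valid⇒J v _ p) ,
      λ m m<y → let k , r = q m m<y in k , go c (pairℕ x m) (suc k) (Valid⇒J v _ r)

Eventually : (ℕ → Set) → Set
Eventually A = ∃[ N ] ∀ n → N ≤ n → A n

Eventually-× : ∀ {A B C} → Eventually A → Eventually B → (∀ n → A n → B n → C n) → Eventually C
Eventually-× (N , p) (M , q) f = N ⊔ M , λ n h → f n (p n (m⊔n≤o⇒m≤o N M h)) (q n (m⊔n≤o⇒n≤o N M h))

Eventually-map : ∀ {A B} → Eventually A → (∀ n → A n → B n) → Eventually B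
Eventually-map (N , p) f = N , λ n h → f n (p n h)

Eventually-∀< : ∀ {A : ℕ → ℕ → Set} y → (∀ m → m < y → Eventually (A m)) → Eventually (λ n → ∀ m → m < y → A m n)
Eventually-∀< zero    h = 0 , λ n _ m ()
Eventually-∀< {A} (suc y) h = Eventually-× (h y ≤-refl) (Eventually-∀< y (λ m m<y → h m (m<n⇒m<1+n m<y)))
  λ n p q m m<1+y → split n p q m m<1+y
  where
  split : ∀ n → A y n → (∀ m → m < y → A m n) → ∀ m → m < suc y → A m n
  split n p q m m<1+y with m<1+n⇒m<n∨m≡n m<1+y
  ... | inj₁ m<y  = q m m<y
  ... | inj₂ refl = p

module _ {g : Baire} where
  -- A halting computation queries the oracle finitely often. Asking for derivations from all
  -- sufficiently long prefixes lets the premises be met at a common length.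
  ev-complete : ∀ c {x y} → ⟦ c ⟧ g x y → Eventually (λ n → Der (evᶠ (pre g n) c x y))
  ev-complete c = go c _ _
    where
    E : Code → ℕ → ℕ → ℕ → Fact
    E c x y n = evᶠ (pre g n) c x y
    go : ∀ c x y → ⟦ c ⟧ g x y → Eventually (λ n → Der (E c x y n))
    go zeroᶜ       x y h = 0 , λ n _ → axiom (E zeroᶜ x y n) h
    go succᶜ       x y h = 0 , λ n _ → axiom (E succᶜ x y n) h
    go leftᶜ       x y h = 0 , λ n _ → axiom (E leftᶜ x y n) h
    go rightᶜ      x y h = 0 , λ n _ → axiom (E rightᶜ x y n) h
    go oracleᶜ     x y refl = suc x , λ n x<n → axiom (E oracleᶜ x y n) (∈-pre x n x<n)
    go (pairᶜ c d) x _ (u , v , p , q , refl) = Eventually-× (go c x u p) (go d x v q) λ n r s →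
      derive (E (pairᶜ c d) x _ n) (both-∈ r s) λ {l} (a , b) →
        subst (λ w → E c x w n ∈ l) (sym (π₁-pair u v)) a , subst (λ w → E d x w n ∈ l) (sym (π₂-pair u v)) b
    go (compᶜ c d) x y (z , p , q) = Eventually-× (go d x z p) (go c z y q) λ n r s →
      derive (E (compᶜ c d) x y n) (both-∈ r s) λ (a , b) → z , a , b
    go (precᶜ c d) x y h = rec (π₂ x) x y refl h
      where
      rec : ∀ n x y → π₂ x ≡ n → PrimRec (⟦ c ⟧ g) (⟦ d ⟧ g) (π₁ x) n y →
        Eventually (λ n → Der (E (precᶜ c d) x y n))
      rec zero    x y e h = Eventually-map (go c (π₁ x) y h) λ n r →
        derive (E (precᶜ c d) x y n) r λ a → inj₁ (e , a)
      rec (suc m) x y e (z , p , q) = Eventually-×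
        (rec m (pairℕ (π₁ x) m) z (π₂-pair (π₁ x) m)
          (subst (λ a → PrimRec (⟦ c ⟧ g) (⟦ d ⟧ g) a m z) (sym (π₁-pair (π₁ x) m)) p))
        (go d (pairℕ (π₁ x) (pairℕ m z)) y q) λ n r s →
        derive (E (precᶜ c d) x y n) (both-∈ r s) λ (a , b) → inj₂ (m , z , e , a , b)
    go (rfindᶜ c) x y (p , q) = Eventually-× (go c (pairℕ x y) 0 p)
      (Eventually-∀< y λ m m<y → Eventually-map (go c (pairℕ x m) _ (proj₂ (q m m<y)))
        λ n (l , v , a) → l , v , _ , a)
      λ n r s → derive (E (rfindᶜ c) x y n)
        (both {Q = λ l → ∀ m → m < y → P n m l} ∈-++⁺ˡ
          (λ h m m<y → let k , a = h m m<y in k , ∈-++⁺ʳ _ a) r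
          (collect {P n} (λ s (k , a) → k , s a) y s))
        id
      where
      P : ℕ → ℕ → List Fact → Set
      P n m l = ∃[ k ] E c (pairℕ x m) (suc k) n ∈ l

-- Continuity: a derivation from a prefix is sound for every oracle that extends this prefix.
use : ∀ c {g x y} → ⟦ c ⟧ g x y → ∃[ N ] ∀ g′ → (∀ j → j < N → g′ j ≡ g j) → ⟦ c ⟧ g′ x y
use c h with N , p ← ev-complete c h with l , v , a ← p N ≤-refl =
  N , λ g′ e → ev-sound (Validᶠ⇒Valid v) (extends-pre N e) c (∈-map⁺ code a)

⟦⟧-resp : ∀ c {g g′ x y} → g ≗ g′ → ⟦ c ⟧ g x y → ⟦ c ⟧ g′ x y
⟦⟧-resp c e h = proj₂ (use c h) _ λ j _ → sym (e j)

-- Limits and modifications of points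

increasing⇒≥ : ∀ {N : ℕ → ℕ} → (∀ k → N k < N (suc k)) → ∀ k → k ≤ N k
increasing⇒≥ inc zero    = z≤n
increasing⇒≥ inc (suc k) = ≤-<-trans (increasing⇒≥ inc k) (inc k)

limit : (x : ℕ → Baire) (N : ℕ → ℕ) → (∀ k → N k < N (suc k)) →
  (∀ k j → j < N k → x (suc k) j ≡ x k j) → ∃[ X ] ∀ k j → j < N k → X j ≡ x k j
-- Entry `j` is settled at stage `suc j`, because `N (suc j)` is at least `suc j`.
limit x N inc agree = (λ j → x (suc j) j) , λ k j j<Nk → lemma k j j<Nk
  where
  N-mono : ∀ k d → N k ≤ N (d + k)
  N-mono k zero    = ≤-refl
  N-mono k (suc d) = ≤-trans (N-mono k d) (<⇒≤ (inc (d + k)))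
  later : ∀ d k j → j < N k → x (d + k) j ≡ x k j
  later zero    k j h = refl
  later (suc d) k j h = trans (agree (d + k) j (≤-trans h (N-mono k d))) (later d k j h)
  later≤ : ∀ {k m} j → k ≤ m → j < N k → x m j ≡ x k j
  later≤ {k} {m} j k≤m h = subst (λ i → x i j ≡ x k j) (m∸n+n≡m k≤m) (later (m ∸ k) k j h)
  lemma : ∀ k j → j < N k → x (suc j) j ≡ x k j
  lemma k j h with ≤-total k (suc j)
  ... | inj₁ k≤ = later≤ j k≤ h
  ... | inj₂ ≤k = sym (later≤ j ≤k (increasing⇒≥ inc (suc j)))

_[_≔_] : Baire → ℕ → ℕ → Baire
(x [ n ≔ a ]) j with j ≟ n
... | yes _ = a
... | no  _ = x j

≔-at : ∀ x n a → (x [ n ≔ a ]) n ≡ a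
≔-at x n a with n ≟ n
... | yes _  = refl
... | no n≢n = contradiction refl n≢n

≔-below : ∀ x n a j → j < n → (x [ n ≔ a ]) j ≡ x j
≔-below x n a j j<n with j ≟ n
... | yes refl = contradiction j<n (<-irrefl refl)
... | no _     = refl

≔-all : ∀ {P : ℕ → ℕ → Set} x n a → P n a → (∀ j → P j (x j)) → ∀ j → P j ((x [ n ≔ a ]) j)
≔-all x n a p h j with j ≟ n
... | yes refl = p
... | no _     = h j

pre-≔ : ∀ x n a → pre (x [ n ≔ a ]) (suc n) ≡ pairℕ n a ∷ pre x n
pre-≔ x n a = cong₂ (λ b σ → pairℕ n b ∷ σ) (≔-at x n a) (pre-cong n (≔-below x n a))

-- Bounds on codes, and killed values

cap≤cap-suc : ∀ n → cap n ≤ cap (suc n)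
cap≤cap-suc n = m≤n⇒m≤1+n (m≤n⇒m≤1+n (y≤pair (pairℕ n (base n)) (cap n)))

cap-mono : ∀ {m n} → m ≤ n → cap m ≤ cap n
cap-mono m≤n = go (≤⇒≤′ m≤n)
  where
  go : ∀ {m n} → m ≤′ n → cap m ≤ cap n
  go ≤′-refl     = ≤-refl
  go (≤′-step {n} h) = ≤-trans (go h) (cap≤cap-suc n)

base≤cap : ∀ {q n} → q < n → base q ≤ cap n
base≤cap {q} {n} q<n = ≤-trans (≤-trans (≤-trans (y≤pair q (base q)) (x≤pair (pairℕ q (base q)) (cap q)))
  (≤-trans (n≤1+n _) (n≤1+n _))) (cap-mono q<n)

-- `cap` repeats the recursion of `snoc` with `base n` and `cap n` as upper bounds for the new value
-- and the old string; the pairing is monotone.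
code-pre< : ∀ {x} n → (∀ j → x j < base j) → codeList (pre x n) < cap n
code-pre< zero        h = ≤-refl
code-pre< {x} (suc n) h = s≤s (s≤s (pair-mono (pair-mono (≤-refl {n}) (<⇒≤ (h n))) (<⇒≤ (code-pre< n h))))

-- Each guard kills at most the value in its first certificate. The existence of a guard and a
-- certificate is a Σ⁰₁ condition, so avoiding killed values is a Π⁰₁ one.
Killed : ℕ → ℕ → Set
Killed q v = ∃[ ρ ] ρ < cap q × (∃[ s ] True (first q ρ s) × π₁ s ≡ v)

first-unique : ∀ q ρ {s t} → True (first q ρ s) → True (first q ρ t) → s ≡ t
first-unique q ρ {s} {t} p p′ with <-cmp s t
... | tri≈ _ e _ = e
... | tri< s<t _ _ = contradiction (proj₁ (to (first-T q ρ s) p)) (proj₂ (to (first-T q ρ t) p′) s s<t)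
... | tri> _ _ t<s = contradiction (proj₁ (to (first-T q ρ t) p′)) (proj₂ (to (first-T q ρ s) p) t t<s)

least : ∀ (f : ℕ → ℕ) n → True (f n) → ∃[ m ] True (f m) × (∀ k → k < m → ¬ True (f k))
least f n h = go n 0 (λ _ ()) (+-identityʳ n)
  where
  go : ∀ d m → (∀ k → k < m → ¬ True (f k)) → d + m ≡ n → ∃[ m ] True (f m) × (∀ k → k < m → ¬ True (f k))
  go d m below e with True? (f m)
  ... | yes p = m , p , below
  go zero    m below refl | no ¬p = contradiction h ¬p
  go (suc d) m below e    | no ¬p = go d (suc m) below′ (trans (+-suc d m) e)
    where
    below′ : ∀ k → k < suc m → ¬ True (f k)
    below′ k k<1+m with m<1+n⇒m<n∨m≡n k<1+m
    ... | inj₁ k<m  = below k k<m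
    ... | inj₂ refl = ¬p

-- Counting

module _ (em : ExcludedMiddle 0ℓ) where

  ind : Set → ℕ
  ind P with em {P}
  ... | yes _ = 1
  ... | no  _ = 0

  ind-T : ∀ P → True (ind P) ⇔ P
  ind-T P with em {P}
  ... | yes p = mk⇔ (λ _ → p) (λ _ → z<s)
  ... | no ¬p = mk⇔ (λ ()) (λ p → contradiction p ¬p)

  ind-mono : ∀ {P Q : Set} → (P → Q) → ind P ≤ ind Q
  ind-mono {P} {Q} f with em {P} | em {Q}
  ... | yes p | yes _ = ≤-refl
  ... | yes p | no ¬q = contradiction (f p) ¬q
  ... | no _  | _     = z≤n

  ind-⊎ : ∀ P Q → ind (P ⊎ Q) ≤ ind P + ind Q
  ind-⊎ P Q with em {P ⊎ Q} | em {P} | em {Q}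
  ... | no _         | _     | _     = z≤n
  ... | yes _        | yes _ | _     = s≤s z≤n
  ... | yes _        | no _  | yes _ = ≤-refl
  ... | yes (inj₁ p) | no ¬p | no _  = contradiction p ¬p
  ... | yes (inj₂ q) | no _  | no ¬q = contradiction q ¬q

  count : (ℕ → Set) → ℕ → ℕ
  count P n = sum (λ a → ind (P a)) n

  count-mono : ∀ {P Q : ℕ → Set} → (∀ a → P a → Q a) → ∀ n → count P n ≤ count Q n
  count-mono h n = sum-mono n λ a _ → ind-mono (h a)

  count-⊎ : ∀ P Q n → count (λ a → P a ⊎ Q a) n ≤ count P n + count Q n
  count-⊎ P Q zero    = z≤n
  count-⊎ P Q (suc n) = ≤-trans (+-mono-≤ (ind-⊎ (P n) (Q n)) (count-⊎ P Q n))
    (≤-reflexive (interchange (ind (P n)) (ind (Q n)) (count P n) (count Q n)))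
    where open import Algebra.Properties.CommutativeSemigroup +-commutativeSemigroup using (interchange)

  count-empty : ∀ P n → (∀ a → ¬ P a) → count P n ≡ 0
  count-empty P zero    h = refl
  count-empty P (suc n) h = cong₂ _+_ (¬True⇒≡0 (h n ∘ to (ind-T (P n)))) (count-empty P n h)

  -- The union bound, by splitting off one set at a time.
  count-∃ : ∀ (P : ℕ → ℕ → Set) k m n → (∀ t → t < m → count (P t) n ≤ k) →
    count (λ a → ∃[ t ] t < m × P t a) n ≤ m * k
  count-∃ P k zero    n h = ≤-reflexive (count-empty _ n λ { _ (_ , () , _) })
  count-∃ P k (suc m) n h = ≤-trans (count-mono split n) (≤-trans (count-⊎ _ _ n)
    (+-mono-≤ (h m ≤-refl) (count-∃ P k m n λ t t<m → h t (m<n⇒m<1+n t<m))))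
    where
    split : ∀ a → (∃[ t ] t < suc m × P t a) → P m a ⊎ (∃[ t ] t < m × P t a)
    split a (t , t<1+m , p) with m<1+n⇒m<n∨m≡n t<1+m
    ... | inj₁ t<m  = inj₂ (t , t<m , p)
    ... | inj₂ refl = inj₁ p

  count-unique : ∀ (P : ℕ → Set) n → (∀ {a b} → P a → P b → a ≡ b) → count P n ≤ 1
  count-unique P zero    h = z≤n
  count-unique P (suc n) h with em {P n}
  ... | no _  = count-unique P n h
  ... | yes p = s≤s (≤-reflexive (go n ≤-refl))
    where
    go : ∀ m → m ≤ n → count P m ≡ 0
    go zero    _   = refl
    go (suc m) m<n = cong₂ _+_ (¬True⇒≡0 λ t → <⇒≢ m<n (h (to (ind-T (P m)) t) p)) (go m (<⇒≤ m<n))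

  -- Pigeonhole: the marks outnumber the elements of `P`, so some mark falls outside.
  pick : ∀ (χ : ℕ → ℕ) (P : ℕ → Set) n → count P n < sum (sg ∘ χ) n → ∃[ a ] a < n × True (χ a) × ¬ P a
  pick χ P n h with em {∃[ a ] a < n × True (χ a) × ¬ P a}
  ... | yes p = p
  ... | no ¬p = contradiction (sum-mono n le) (<⇒≱ h)
    where
    le : ∀ a → a < n → sg (χ a) ≤ ind (P a)
    le a a<n with em {P a} | True? (χ a)
    ... | yes _ | _     = sg≤1 (χ a)
    ... | no ¬q | yes t = contradiction (a , a<n , t , ¬q) ¬p
    ... | no _  | no ¬t = ≤-reflexive (cong sg (¬True⇒≡0 ¬t))

  ones : ∀ n → sum (λ _ → 1) n ≡ n
  ones zero    = refl
  ones (suc n) = cong suc (ones n)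

  pick-any : ∀ (P : ℕ → Set) n → count P n < n → ∃[ a ] a < n × ¬ P a
  pick-any P n h with a , a<n , _ , p ← pick (λ _ → 1) P n (subst (count P n <_) (sym (ones n)) h) = a , a<n , p

  -- There are `cap q` guards, and the first certificate for a guard is unique.
  count-Killed : ∀ q → count (Killed q) (base q) ≤ cap q
  count-Killed q = ≤-trans (count-∃ P 1 (cap q) (base q) λ ρ _ → count-unique (P ρ) (base q)
      λ (s , p , e) (t , p′ , e′) → trans (sym e) (trans (cong π₁ (first-unique q ρ p p′)) e′))
    (≤-reflexive (*-identityʳ (cap q)))
    where
    P : ℕ → ℕ → Set
    P ρ v = ∃[ s ] True (first q ρ s) × π₁ s ≡ v

  -- The constraint at `q` is waived because it belongs to the side under attack; the point has only
  -- to serve the other sides.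
  Avoids : ℕ → Baire → Set
  Avoids q x = ∀ j → x j < base j × (j ≢ q → ¬ Killed j (x j))

  unkilled : ∀ n → ∃[ a ] a < base n × ¬ Killed n a
  unkilled n = pick-any (Killed n) (base n) (s≤s (≤-trans (count-Killed n) (m≤m+n (cap n) _)))

  ≔-Avoids : ∀ {q x} n a → a < base n → (n ≢ q → ¬ Killed n a) → Avoids q x → Avoids q (x [ n ≔ a ])
  ≔-Avoids {q} {x} n a a<b k h = ≔-all {λ j b → b < base j × (j ≢ q → ¬ Killed j b)} x n a (a<b , k) h

  -- Defeating one program

  module _ (i : ℕ) (c : Code) where
    private
      q = pairℕ i ⌜ c ⌝

    Big : ℕ → ℕ → List ℕ → Set
    Big v n σ = Der (bgᶠ i c v n σ)

    Big-leaf : ∀ {v n σ} → Der (evᶠ σ c q v) → Big v n σ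
    Big-leaf d = derive (bgᶠ i c _ _ _) d inj₁

    -- Excluded middle decides which children are big; their finitely many derivations are merged
    -- into one list.
    Big-node : ∀ {v n σ} → cap n < count (λ a → Big v (suc n) (pairℕ n a ∷ σ)) (base n) → Big v n σ
    Big-node {v} {n} {σ} h = derive (bgᶠ i c v n σ)
      (collect {λ a l → True (χ a) → child a ∈ l} (λ s p → s ∘ p) (base n) λ a _ → single a)
      λ p → inj₂ (χ , ≤-trans h (sum-mono (base n) λ a _ → ind≤sg (Big v (suc n) (pairℕ n a ∷ σ))) , p)
      where
      child : ℕ → Fact
      child a = bgᶠ i c v (suc n) (pairℕ n a ∷ σ)
      χ : ℕ → ℕ
      χ a = ind (Big v (suc n) (pairℕ n a ∷ σ))
      ind≤sg : ∀ P → ind P ≤ sg (ind P)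
      ind≤sg P with em {P}
      ... | yes _ = ≤-refl
      ... | no _  = z≤n
      single : ∀ a → Derivation (λ l → True (χ a) → child a ∈ l)
      single a with em {Big v (suc n) (pairℕ n a ∷ σ)}
      ... | yes (l , w , p) = l , w , λ _ → p
      ... | no _            = [] , tt , λ ()

    -- A big string has more children than there are killed values, so the tree can be
    -- climbed to a leaf along unkilled values.
    climb : ∀ l → Valid l → ∀ {v n x} → q < n → Avoids q x → code (bgᶠ i c v n (pre x n)) ∈ l →
      ∃[ x′ ] Avoids q x′ × ⟦ c ⟧ x′ q v
    climb (w ∷ l) (_ , V) q<n A (there p) = climb l V q<n A p
    climb (w ∷ l) (p , V) {v} {n} {x} q<n A (here refl) with to (just-T l (bgᶠ i c v n (pre x n))) p
    ... | inj₁ e = x , A , ev-sound V (extends-pre n λ _ _ → refl) c e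
    ... | inj₂ (χ , big , sub)
      with a , a<b , t , ¬k ← pick χ (Killed n) (base n) (≤-trans (s≤s (count-Killed n)) big) =
      climb l V (m<n⇒m<1+n q<n) (≔-Avoids n a a<b (λ _ → ¬k) A)
        (subst (λ σ → code (bgᶠ i c v (suc n) σ) ∈ l) (sym (pre-≔ x n a)) (sub a a<b t))

    NotBig : ℕ → Baire → Set
    NotBig n x = ∀ v → v < base q → ¬ Big v n (pre x n)

    -- Union bound: at most `cap n` values are killed, and each of the `base q` possible outputs,
    -- which number at most `cap n`, has a tree above at most `cap n` children, since otherwise the
    -- node itself would be big. Together this excludes fewer than `base n` values.
    grow : ∀ n x → q < n → Avoids q x → NotBig n x → ∃[ a ] Avoids q (x [ n ≔ a ]) × NotBig (suc n) (x [ n ≔ a ])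
    grow n x q<n A nb = let a , a<b , ¬p = pick-any P (base n) (s≤s few) in
      a , ≔-Avoids n a a<b (λ _ → ¬p ∘ inj₁) A ,
      λ v v<b B → ¬p (inj₂ (v , v<b , subst (Big v (suc n)) (pre-≔ x n a) B))
      where
      C P : ℕ → Set
      C a = ∃[ v ] v < base q × Big v (suc n) (pairℕ n a ∷ pre x n)
      P a = Killed n a ⊎ C a
      few : count P (base n) ≤ suc (cap n) * cap n
      few = ≤-trans (count-⊎ (Killed n) C (base n)) (+-mono-≤ (count-Killed n)
        (≤-trans (count-∃ (λ v a → Big v (suc n) (pairℕ n a ∷ pre x n)) (cap n) (base q) (base n)
          λ v v<b → ≮⇒≥ λ h → nb v v<b (Big-node h))
        (*-monoˡ-≤ (cap n) (base≤cap q<n))))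

    -- Iterates `grow` and passes to the limit. Were the program to output some `v` there, a long
    -- enough prefix would derive this and be big as a leaf.
    stay : ∀ x → Avoids q x → NotBig (suc q) x → ∃[ X ] Avoids q X × (∀ v → v < base q → ¬ ⟦ c ⟧ X q v)
    stay x₀ A₀ nb₀ = X , A , none
      where
      N : ℕ → ℕ
      N k = k + suc q
      State : ℕ → Set
      State k = ∃[ x ] Avoids q x × NotBig (N k) x
      next′ : ∀ k → State k → State (suc k)
      next′ k (x , A , nb) = let a , s = grow (N k) x (m≤n+m (suc q) k) A nb in (x [ N k ≔ a ]) , s
      state : ∀ k → State k
      state zero    = x₀ , A₀ , nb₀
      state (suc k) = next′ k (state k)
      x : ℕ → Baire
      x k = proj₁ (state k)
      lim : ∃[ X ] ∀ k j → j < N k → X j ≡ x k j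
      lim = limit x N (λ k → ≤-refl) λ k j j<N → ≔-below (x k) (N k) _ j j<N
      X : Baire
      X = proj₁ lim
      A : Avoids q X
      A j = subst (λ a → a < base j × (j ≢ q → ¬ Killed j a)) (sym (proj₂ lim (suc j) j (m≤m+n (suc j) (suc q))))
        (proj₁ (proj₂ (state (suc j))) j)
      none : ∀ v → v < base q → ¬ ⟦ c ⟧ X q v
      none v v<b h = let M , d = ev-complete c h in
        proj₂ (proj₂ (state M)) v v<b (subst (Big v (N M)) (pre-cong (N M) (proj₂ lim M))
          (Big-leaf (d (N M) (m≤m+n M (suc q)))))

    -- If the search for the guard succeeds, the killed value is the program's only output at `q` on
    -- the leaf reached. If it fails, there is no tree and `stay` applies.
    diagonal : ∃[ x ] Avoids q x × (∀ v → v < base q → ¬ Killed q v → ¬ ⟦ c ⟧ x q v)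
    diagonal = go em
      where
      d : Baire
      d n = proj₁ (unkilled n)
      x₀ : Baire
      -- The entry matches the `0` that `cert` appends to the guard; it may be killed, since the
      -- constraint at `q` is waived.
      x₀ = d [ q ≔ 0 ]
      A₀ : Avoids q x₀
      A₀ = ≔-Avoids q 0 z<s (λ q≢q → contradiction refl q≢q) λ j →
        proj₁ (proj₂ (unkilled j)) , λ _ → proj₂ (proj₂ (unkilled j))
      ρ : ℕ
      ρ = codeList (pre d q)
      goal : ℕ → ℕ
      goal v = bg q v (suc q) (snoc q 0 ρ)
      go : Dec (∃[ s ] True (cert q ρ s)) →
        ∃[ x ] Avoids q x × (∀ v → v < base q → ¬ Killed q v → ¬ ⟦ c ⟧ x q v)
      go (yes (s₀ , h))
        with s , p , below ← least (cert q ρ) s₀ h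
        with l , refl′ ← codeList-surjective (π₂ s)
        with V , m ← to (cert-T q ρ s) p
        with x , A , halts ← climb l (to (valid-T l) (subst (True ∘ valid) (sym refl′) V)) ≤-refl A₀
               (subst (λ σ → code (bgᶠ i c (π₁ s) (suc q) σ) ∈ l) (sym (pre-≔ d q 0))
                 (to (mem-T (goal (π₁ s)) l) (subst (True ∘ mem (goal (π₁ s))) (sym refl′) m))) =
        x , A , λ v _ ¬k h′ → ¬k (ρ , code-pre< q (λ j → proj₁ (proj₂ (unkilled j))) , s ,
          from (first-T q ρ s) (p , below) ,
          ⟦⟧-functional c halts h′)
      go (no ¬cert) = let x , A , none = stay x₀ A₀ nb in x , A , λ v v<b _ → none v v<b
        where
        nb : NotBig (suc q) x₀
        -- A derivation of bigness, paired with `v`, would be a certificate.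
        nb v _ (l , V , p) = ¬cert (s , from (cert-T q ρ s)
          ( subst (True ∘ valid) (sym (π₂-pair v (codeList L))) (from (valid-T L) (Validᶠ⇒Valid V))
          , subst₂ (λ a b → True (mem (goal a) b)) (sym (π₁-pair v (codeList L))) (sym (π₂-pair v (codeList L)))
              (from (mem-T (goal v) L) (∈-map⁺ code (subst (λ σ → bgᶠ i c v (suc q) σ ∈ l) (pre-≔ d q 0) p)))))
          where
          L = map code l
          s = pairℕ v (codeList L)

-- The classes in Cantor space

-- A unary encoding in which every point of Cantor space codes a point bounded by base.
decode : Baire → Baire
decode h q = sum (λ t → h (pairℕ q t)) (base′ q)

tail : Baire → Baire
tail y n = y (suc n)

row : Baire → ℕ → Baire
row g k m = g (pairℕ k m)

sum-cong : ∀ {f h : ℕ → ℕ} n → (∀ a → a < n → f a ≡ h a) → sum f n ≡ sum h n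
sum-cong zero    e = refl
sum-cong (suc n) e = cong₂ _+_ (e n ≤-refl) (sum-cong n λ a a<n → e a (m<n⇒m<1+n a<n))

decode-cong : ∀ h h′ q → (∀ t → t < base′ q → h (pairℕ q t) ≡ h′ (pairℕ q t)) → decode h q ≡ decode h′ q
decode-cong h h′ q = sum-cong (base′ q)

-- The first entry of y names a family of constraints, those q with π₁ q ≡ y 0.
Obeys : Baire → ℕ → Set
Obeys y q = π₁ q ≡ y 0 → ¬ Killed q (decode (tail y) q)

-- With all constraints imposed on every row, the first row would already be a point of `Labelled`.
-- With finitely many per row, any finite part can be continued by rows of either label.
Rowwise Labelled : Pred Baire 0ℓ
Labelled y = 2^ℕ y × (∀ q → Obeys y q)
Rowwise g = 2^ℕ g × (∀ k q → q < k → Obeys (row g k) q)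

opaque
  -- The decidable matrix of the Σ⁰₁ condition that `y` violates its constraint at `q`.
  bad : Baire → ℕ → ℕ → ℕ → ℕ
  bad y q ρ s = (eq (π₁ q) (y 0) * lt ρ (cap q)) * (first q ρ s * eq (π₁ s) (decode (tail y) q))

  bad-T : ∀ y q ρ s → True (bad y q ρ s) ⇔
    ((π₁ q ≡ y 0 × ρ < cap q) × (True (first q ρ s) × π₁ s ≡ decode (tail y) q))
  bad-T y q ρ s = mk⇔
    (λ h → let u , v = to A h ; a , b = to B u ; c , d = to C v in
      (to (eq-T _ _) a , to (lt-T ρ (cap q)) b) , c , to (eq-T _ _) d)
    (λ ((a , b) , c , d) → from A (from B (from (eq-T _ _) a , from (lt-T ρ (cap q)) b) ,
      from C (c , from (eq-T _ _) d)))
    where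
    A : True (bad y q ρ s) ⇔
      (True (eq (π₁ q) (y 0) * lt ρ (cap q)) × True (first q ρ s * eq (π₁ s) (decode (tail y) q)))
    A = *-T (eq (π₁ q) (y 0) * lt ρ (cap q)) (first q ρ s * eq (π₁ s) (decode (tail y) q))
    B : True (eq (π₁ q) (y 0) * lt ρ (cap q)) ⇔ (True (eq (π₁ q) (y 0)) × True (lt ρ (cap q)))
    B = *-T (eq (π₁ q) (y 0)) (lt ρ (cap q))
    C : True (first q ρ s * eq (π₁ s) (decode (tail y) q)) ⇔
      (True (first q ρ s) × True (eq (π₁ s) (decode (tail y) q)))
    C = *-T (first q ρ s) (eq (π₁ s) (decode (tail y) q))

Obeys⇔ : ∀ y q → Obeys y q ⇔ (∀ ρ s → ¬ True (bad y q ρ s))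
Obeys⇔ y q = mk⇔
  (λ h ρ s t → let (a , b) , c , d = to (bad-T y q ρ s) t in h a (ρ , b , s , c , d))
  (λ h a (ρ , b , s , c , d) → h ρ s (from (bad-T y q ρ s) ((a , b) , c , d)))

Obeys-resp : ∀ y y′ q → y 0 ≡ y′ 0 → (∀ t → t < base′ q → tail y (pairℕ q t) ≡ tail y′ (pairℕ q t)) →
  Obeys y q → Obeys y′ q
Obeys-resp y y′ q e d h a = subst (¬_ ∘ Killed q) (decode-cong (tail y) (tail y′) q d) (h (trans a (sym e)))

Labelled-resp : ∀ {y y′} → y ≗ y′ → Labelled y → Labelled y′
Labelled-resp {y} {y′} e (b , o) = (λ n → subst (_< 2) (e n) (b n)) ,
  λ q → Obeys-resp y y′ q (e 0) (λ t _ → e (suc (pairℕ q t))) (o q)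

Rowwise-resp : ∀ {g g′} → g ≗ g′ → Rowwise g → Rowwise g′
Rowwise-resp {g} {g′} e (b , o) = (λ n → subst (_< 2) (e n) (b n)) ,
  λ k q q<k → Obeys-resp (row g k) (row g′ k) q (e (pairℕ k 0)) (λ t _ → e (pairℕ k (suc (pairℕ q t)))) (o k q q<k)

-- Indices and Π⁰₁ classes

opaque
  codeIndex : Code → ℕ
  codeIndex = ⌜_⌝

  codeIndex-φ : ∀ c {g x y} → ⟦ c ⟧ g x y → φ (codeIndex c) g x y
  codeIndex-φ c h = c , refl , h

  index : ∀ {f} → Cmp f → ℕ
  index (c , _) = ⌜ c ⌝

  index-φ : ∀ {f} (F : Cmp f) g x → φ (index F) g x (f g x)
  index-φ (c , p) g x = c , refl , p g x

  index-functional : ∀ {f} (F : Cmp f) {g x y} → φ (index F) g x y → y ≡ f g x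
  index-functional (c , p) {g} {x} (d , e , h) with refl ← ⌜⌝-injective d c e = ⟦⟧-functional c h (p g x)

Π⁰₁-intro : ∀ {S : Pred Baire 0ℓ} {f} → Cmp f → (∀ x → S x ⇔ (2^ℕ x × (∀ n → True (f x n)))) → Π⁰₁ S
Π⁰₁-intro {S} {f} F equiv = index G , total , λ x → mk⇔
    (λ s → let b , h = to (equiv x) s in b , λ n → subst (φ (index G) x n) (one (h n)) (index-φ G x n))
    (λ (b , h) → from (equiv x) (b , λ n → to (sg-T (f x n))
      (subst True (index-functional G (h n)) z<s)))
  where
  G : Cmp (λ g x → sg (f g x))
  G = sg-c F
  one : ∀ {m} → True m → sg m ≡ 1
  one {suc m} _ = refl
  bit : ∀ e {x n} m → φ e x n (sg m) → φ e x n 0 ⊎ φ e x n 1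
  bit e zero    h = inj₁ h
  bit e (suc m) h = inj₂ h
  total : ∀ x → 2^ℕ x → ∀ n → φ (index G) x n 0 ⊎ φ (index G) x n 1
  total x _ n = bit (index G) (f x n) (index-φ G x n)

opaque
  unfolding bad
  -- `Y` stands for a point obtained from the oracle, which covers both a whole point and one of its
  -- rows; programs are supplied for the label and the bits that `bad` reads.
  bad-c : ∀ {Y : Baire → ℕ → Baire} {q ρ s} → Cmp q → Cmp ρ → Cmp s → Cmp (λ g x → Y g x 0) →
    Cmp (λ g x → Y g (π₂ x) (suc (pairℕ (q g (π₂ x)) (π₁ x)))) →
    Cmp (λ g x → bad (Y g x) (q g x) (ρ g x) (s g x))
  bad-c {Y} {q} CQ Cρ CS C0 CY = *-c (*-c (eq-c (π₁-c CQ) C0) (lt-c Cρ (cap-c CQ)))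
    (*-c (first-c CQ Cρ CS) (eq-c (π₁-c CS)
      (sum-c {f = λ g x t → Y g x (suc (pairℕ (q g x) t))} (base′-c CQ) CY)))

Π⁰₁-Labelled : Π⁰₁ Labelled
Π⁰₁-Labelled = Π⁰₁-intro {f = f} F λ x → mk⇔
    (λ (b , o) → b , λ n → from (isz-T (bad x (π₁ n) (π₁ (π₂ n)) (π₂ (π₂ n))))
      (to (Obeys⇔ x (π₁ n)) (o (π₁ n)) (π₁ (π₂ n)) (π₂ (π₂ n))))
    (λ (b , h) → b , λ q → from (Obeys⇔ x q) λ ρ s → to (isz-T (bad x q ρ s))
      (subst True (at x q ρ s) (h (pairℕ q (pairℕ ρ s)))))
  where
  f : Baire → ℕ → ℕ
  f g n = isz (bad g (π₁ n) (π₁ (π₂ n)) (π₂ (π₂ n)))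
  F : Cmp f
  F = isz-c (bad-c {Y = λ g _ → g} v0 v1 (π₂-c tail-c) (oracle-c (const-c 0))
    (oracle-c (suc-c (pair-c v1 v0))))
  at : ∀ x q ρ s → f x (pairℕ q (pairℕ ρ s)) ≡ isz (bad x q ρ s)
  at x q ρ s rewrite unpair-pair q (pairℕ ρ s) | unpair-pair ρ s = refl

Π⁰₁-Rowwise : Π⁰₁ Rowwise
Π⁰₁-Rowwise = Π⁰₁-intro {f = f} F λ x → mk⇔
    (λ (b , o) → b , λ n → pass x (π₁ n) (π₁ (π₂ n)) (π₁ (π₂ (π₂ n))) (π₂ (π₂ (π₂ n))) (o _ _))
    (λ (b , h) → b , λ k q q<k → from (Obeys⇔ (row x k) q) λ ρ s t →
      to (isz-T (lt q k * bad (row x k) q ρ s))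
        (subst True (at x k q ρ s) (h (pairℕ k (pairℕ q (pairℕ ρ s)))))
        (from (*-T (lt q k) (bad (row x k) q ρ s)) (from (lt-T q k) q<k , t)))
  where
  test : Baire → ℕ → ℕ → ℕ → ℕ → ℕ
  test g k q ρ s = isz (lt q k * bad (row g k) q ρ s)
  f : Baire → ℕ → ℕ
  f g n = test g (π₁ n) (π₁ (π₂ n)) (π₁ (π₂ (π₂ n))) (π₂ (π₂ (π₂ n)))
  F : Cmp f
  F = isz-c (*-c (lt-c v1 v0) (bad-c {Y = λ g n → row g (π₁ n)} v1 v2 (π₂-c (π₂-c tail-c))
    (oracle-c (pair-c v0 (const-c 0))) (oracle-c (pair-c v1 (suc-c (pair-c v2 v0))))))
  at : ∀ x k q ρ s → f x (pairℕ k (pairℕ q (pairℕ ρ s))) ≡ test x k q ρ s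
  at x k q ρ s rewrite unpair-pair k (pairℕ q (pairℕ ρ s)) | unpair-pair q (pairℕ ρ s) | unpair-pair ρ s = refl
  pass : ∀ x k q ρ s → (q < k → Obeys (row x k) q) → True (test x k q ρ s)
  pass x k q ρ s o = from (isz-T (lt q k * bad (row x k) q ρ s)) λ t →
    let u , v = to (*-T (lt q k) (bad (row x k) q ρ s)) t in
    to (Obeys⇔ (row x k) q) (o (to (lt-T q k) u)) ρ s v

-- Constant learners and the computable reduction

φ-resp : ∀ e {g g′} → g ≗ g′ → ∀ {x y} → φ e g x y → φ e g′ x y
φ-resp e eq′ (c , p , h) = c , p , ⟦⟧-resp c eq′ h

Φ-resp : ∀ e {g g′ h h′} → g ≗ g′ → h ≗ h′ → Φ e g h → Φ e g′ h′
Φ-resp e {g} {g′} eg eh p n = φ-resp e eg (subst (φ e g n) (eh n) (p n))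

ΦFun : ℕ → PartialFun
ΦFun e = record { graph = Φ e ; functional = Φ-functional e ; respects = Φ-resp e }

const-learner : ∀ k → IsLearner (index (const-c k)) (λ _ → k)
const-learner k σ = index-φ (const-c k) _ (codeList σ)

const-identifies : ∀ {k Γ g} → k agreesWith Γ at g → Identifies (λ _ → k) Γ g
const-identifies {k} a = k , (0 , λ _ _ → refl) , a

ΦFun-1ω : ∀ e → ⟨1,ω⟩ (ΦFun e)
ΦFun-1ω e = index (const-c e) , (λ _ → e) , const-learner e ,
  λ g (h , p) → const-identifies {Γ = ΦFun e} (h , p , p)

ΦFun-<ω1 : ∀ e → ⟨<ω,1⟩ (ΦFun e)
ΦFun-<ω1 e = suc e , λ g (h , p) → e , ≤-refl , h , p , p

bounded : ∀ (f : ℕ → ℕ) n → ∃[ b ] ∀ e → e < n → f e < b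
bounded f zero    = 0 , λ e ()
bounded f (suc n) with b , p ← bounded f n = suc (f n) ⊔ b , below
  where
  below : ∀ e → e < suc n → f e < suc (f n) ⊔ b
  below e e<1+n with m<1+n⇒m<n∨m≡n e<1+n
  ... | inj₁ e<n  = ≤-trans (p e e<n) (m≤n⊔m (suc (f n)) b)
  ... | inj₂ refl = m≤m⊔n (suc (f n)) b

-- A program becomes the learner that always guesses it; `bounded` limits the indices of finitely
-- many such learners.
<ω1⇒<ωω : ∀ {Γ} → ⟨<ω,1⟩ Γ → ⟨<ω,ω⟩ Γ
<ω1⇒<ωω {Γ} (n , h) = let b , p = bounded (λ e → index (const-c e)) n in b , λ g d →
  let e , e<n , a = h g d in
  index (const-c e) , p e e<n , (λ _ → e) , const-learner e , const-identifies {Γ = Γ} a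

weaken : ∀ {A B} {C C′ : Pred PartialFun 0ℓ} → (∀ {Γ} → C Γ → C′ Γ) → A ≤[ C ] B → A ≤[ C′ ] B
weaken f (Γ , p , d , v) = Γ , f p , d , v

module _ (C : Pred PartialFun 0ℓ) (C-Φ : ∀ e → C (ΦFun e)) where
  -- Every row is a copy of the given point.
  Rowwise≤Labelled : Rowwise ≤[ C ] Labelled
  Rowwise≤Labelled = ΦFun (index F) , C-Φ _ , (λ {y} _ → (λ n → y (π₂ n)) , index-φ F y) , λ y (b , o) h p →
    Rowwise-resp (Φ-functional _ (index-φ F y) p) ((λ n → b (π₂ n)) , λ k q _ →
      Obeys-resp y (row (λ n → y (π₂ n)) k) q (cong y (sym (π₂-pair k 0)))
        (λ t _ → cong y (sym (π₂-pair k (suc (pairℕ q t))))) (o q))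
    where
    F : Cmp (λ g n → g (π₂ n))
    F = oracle-c tail-c

-- The reduction by two programs

module _ (i : ℕ) where
  private
    good : Baire → ℕ → ℕ → ℕ
    good g n k = lt n k * eq (g (pairℕ k 0)) i

    test : Cmp (λ g x → isz (good g (π₁ (prd (π₁ x))) (π₂ x)))
    test = isz-c (*-c (lt-c (π₁-c (prd-c v0)) tail-c) (eq-c (oracle-c (pair-c tail-c (const-c 0))) (const-c i)))

    -- Entry `suc (pairℕ q t)` is taken from the first row after `q` labelled `i`. Entry `0` comes
    -- from the first such row after `0`, as `prd 0` is `0`, and is therefore `i`.
    readRows : Code
    readRows = compᶜ oracleᶜ (pairᶜ (rfindᶜ (proj₁ test)) (proj₁ id-c))

  readRowsIndex : ℕ
  readRowsIndex = codeIndex readRows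

  Frequent : Pred Baire 0ℓ
  Frequent g = ∀ n → ∃[ k ] n < k × g (pairℕ k 0) ≡ i

  Frequent-resp : ∀ {g g′} → g ≗ g′ → Frequent g → Frequent g′
  Frequent-resp e f n = let k , n<k , p = f n in k , n<k , trans (sym (e (pairℕ k 0))) p

  private
    good-T : ∀ g n k → True (good g n k) ⇔ (n < k × g (pairℕ k 0) ≡ i)
    good-T g n k = mk⇔
      (λ h → let a , b = to T h in to (lt-T n k) a , to (eq-T (g (pairℕ k 0)) i) b)
      (λ (a , b) → from T (from (lt-T n k) a , from (eq-T (g (pairℕ k 0)) i) b))
      where
      T : True (good g n k) ⇔ (True (lt n k) × True (eq (g (pairℕ k 0)) i))
      T = *-T (lt n k) (eq (g (pairℕ k 0)) i)

    module _ (g : Baire) (K : ℕ → ℕ) (K-good : ∀ n → True (good g n (K n)))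
             (K-least : ∀ n k → k < K n → ¬ True (good g n k)) where
      collected : Baire
      collected m = g (pairℕ (K (π₁ (prd m))) m)

      run : ∀ m k v → isz (good g (π₁ (prd m)) k) ≡ v → ⟦ proj₁ test ⟧ g (pairℕ m k) v
      run m k v e = subst (⟦ proj₁ test ⟧ g (pairℕ m k))
        (trans (cong₂ (λ a c → isz (good g (π₁ (prd a)) c)) (π₁-pair m k) (π₂-pair m k)) e)
        (proj₂ test g (pairℕ m k))

      search : ∀ m → ⟦ rfindᶜ (proj₁ test) ⟧ g m (K (π₁ (prd m)))
      search m = run m (K (π₁ (prd m))) 0 (stop (K-good (π₁ (prd m)))) ,
        λ k k<K → 0 , run m k 1 (cong isz (¬True⇒≡0 (K-least (π₁ (prd m)) k k<K)))
        where
        stop : ∀ {a} → True a → isz a ≡ 0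
        stop {suc a} _ = refl

      collected-Φ : Φ readRowsIndex g collected
      collected-Φ m = codeIndex-φ readRows (pairℕ (K (π₁ (prd m))) m ,
        (K (π₁ (prd m)) , m , search m , proj₂ id-c g m , refl) , refl)

      -- All bits for one `q` come from the same row, which lies beyond `q` and so obeys the
      -- constraint at `q`.
      collected-Labelled : Rowwise g → Labelled collected
      collected-Labelled (b , o) = (λ m → b _) , λ q →
        let q<K , label = to (good-T g q (K q)) (K-good q)
            _ , label₀ = to (good-T g 0 (K 0)) (K-good 0) in
        Obeys-resp (row g (K q)) collected q (trans label (sym label₀))
          (λ t _ → cong (λ u → g (pairℕ (K u) (suc (pairℕ q t)))) (sym (π₁-pair q t))) (o (K q) q q<K)

  readRows-Labelled : ∀ {g} → Rowwise g → Frequent g → ∃[ h ] Labelled h × Φ readRowsIndex g h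
  readRows-Labelled {g} p freq =
    collected g K good′ least′ , collected-Labelled g K good′ least′ p , collected-Φ g K good′ least′
    where
    first-good : ∀ n → ∃[ k ] True (good g n k) × (∀ j → j < k → ¬ True (good g n j))
    first-good n = let k , h = freq n in least (good g n) k (from (good-T g n k) h)
    K : ℕ → ℕ
    K n = proj₁ (first-good n)
    good′ : ∀ n → True (good g n (K n))
    good′ n = proj₁ (proj₂ (first-good n))
    least′ : ∀ n k → k < K n → ¬ True (good g n k)
    least′ n = proj₂ (proj₂ (first-good n))

-- `Γ` prefers label 0 whenever it is frequent, which makes it single valued; otherwise the labels,
-- being bits, are frequently 1.
Labelled≤Rowwise : ExcludedMiddle 0ℓ → Labelled ≤[ ⟨<ω,1⟩ ] Rowwise
Labelled≤Rowwise em = Γ , (suc (e₀ ⊔ e₁) , agrees) , (λ {g} p → let h , _ , r = value g p in h , r) ,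
  λ g p h r → let h′ , q , r′ = value g p in Labelled-resp (functional Γ r′ r) q
  where
  e₀ e₁ : ℕ
  e₀ = readRowsIndex 0
  e₁ = readRowsIndex 1
  graph′ : Baire → Baire → Set
  graph′ g h = (Frequent 0 g × Φ e₀ g h) ⊎ (¬ Frequent 0 g × Φ e₁ g h)
  functional′ : ∀ {g h h′} → graph′ g h → graph′ g h′ → h ≗ h′
  functional′ (inj₁ (_ , p)) (inj₁ (_ , q)) = Φ-functional e₀ p q
  functional′ (inj₂ (_ , p)) (inj₂ (_ , q)) = Φ-functional e₁ p q
  functional′ (inj₁ (f , _)) (inj₂ (¬f , _)) = contradiction f ¬f
  functional′ (inj₂ (¬f , _)) (inj₁ (f , _)) = contradiction f ¬f
  respects′ : ∀ {g g′ h h′} → g ≗ g′ → h ≗ h′ → graph′ g h → graph′ g′ h′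
  respects′ eg eh (inj₁ (f , p)) = inj₁ (Frequent-resp 0 eg f , Φ-resp e₀ eg eh p)
  respects′ eg eh (inj₂ (f , p)) = inj₂ (f ∘ Frequent-resp 0 (sym ∘ eg) , Φ-resp e₁ eg eh p)
  Γ : PartialFun
  Γ = record { graph = graph′ ; functional = functional′ ; respects = respects′ }
  agrees : ∀ g → dom Γ g → ∃[ e ] e < suc (e₀ ⊔ e₁) × (e agreesWith Γ at g)
  agrees g (h , inj₁ (f , p)) = e₀ , s≤s (m≤m⊔n e₀ e₁) , h , inj₁ (f , p) , p
  agrees g (h , inj₂ (f , p)) = e₁ , s≤s (m≤n⊔m e₀ e₁) , h , inj₂ (f , p) , p
  value : ∀ g → Rowwise g → ∃[ h ] Labelled h × graph′ g h
  value g p with em {Frequent 0 g}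
  ... | yes f = let h , q , r = readRows-Labelled 0 p f in h , q , inj₁ (f , r)
  ... | no ¬f = let h , q , r = readRows-Labelled 1 p frequent₁ in h , q , inj₂ (¬f , r)
    where
    bit : ∀ {a} → a < 2 → a ≢ 0 → a ≡ 1
    bit {zero}        _             h = contradiction refl h
    bit {suc zero}    _             h = refl
    bit {suc (suc a)} (s≤s (s≤s ())) h
    frequent₁ : Frequent 1 g
    frequent₁ n with em {∃[ k ] n < k × g (pairℕ k 0) ≡ 1}
    ... | yes w = w
    ... | no ¬w = contradiction frequent₀ ¬f
      where
      zero-after : ∀ k → n < k → g (pairℕ k 0) ≡ 0
      zero-after k n<k with g (pairℕ k 0) ≟ 0
      ... | yes z = z
      ... | no ¬z = contradiction (k , n<k , bit (proj₁ p (pairℕ k 0)) ¬z) ¬w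
      frequent₀ : Frequent 0 g
      frequent₀ m = suc (n ⊔ m) , s≤s (m≤n⊔m n m) , zero-after (suc (n ⊔ m)) (s≤s (m≤m⊔n n m))

-- Substituting a program for the oracle

PrimRec-map : ∀ {R R′ S S′ : ℕ → ℕ → Set} → (∀ {x y} → R x y → R′ x y) → (∀ {x y} → S x y → S′ x y) →
  ∀ a n {y} → PrimRec R S a n y → PrimRec R′ S′ a n y
PrimRec-map r s a zero    p           = r p
PrimRec-map r s a (suc n) (z , p , q) = z , PrimRec-map r s a n p , s q

infixl 8 _∘ᶜ_

-- Turns a chain of reductions into a single program to diagonalise against.
_∘ᶜ_ : Code → Code → Code
zeroᶜ     ∘ᶜ d = zeroᶜ
succᶜ     ∘ᶜ d = succᶜ
leftᶜ     ∘ᶜ d = leftᶜ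
rightᶜ    ∘ᶜ d = rightᶜ
oracleᶜ   ∘ᶜ d = d
pairᶜ a b ∘ᶜ d = pairᶜ (a ∘ᶜ d) (b ∘ᶜ d)
compᶜ a b ∘ᶜ d = compᶜ (a ∘ᶜ d) (b ∘ᶜ d)
precᶜ a b ∘ᶜ d = precᶜ (a ∘ᶜ d) (b ∘ᶜ d)
rfindᶜ a  ∘ᶜ d = rfindᶜ (a ∘ᶜ d)

∘ᶜ-run : ∀ {g h} d → (∀ x → ⟦ d ⟧ g x (h x)) → ∀ c {x y} → ⟦ c ⟧ h x y → ⟦ c ∘ᶜ d ⟧ g x y
∘ᶜ-run d D zeroᶜ       p    = p
∘ᶜ-run d D succᶜ       p    = p
∘ᶜ-run d D leftᶜ       p    = p
∘ᶜ-run d D rightᶜ      p    = p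
∘ᶜ-run d D oracleᶜ     refl = D _
∘ᶜ-run d D (pairᶜ a b) (u , v , p , q , e) = u , v , ∘ᶜ-run d D a p , ∘ᶜ-run d D b q , e
∘ᶜ-run d D (compᶜ a b) (z , p , q) = z , ∘ᶜ-run d D b p , ∘ᶜ-run d D a q
∘ᶜ-run d D (precᶜ a b) {x} p = PrimRec-map (∘ᶜ-run d D a) (∘ᶜ-run d D b) (π₁ x) (π₂ x) p
∘ᶜ-run d D (rfindᶜ a)  (p , q) = ∘ᶜ-run d D a p , λ m m<y → let k , r = q m m<y in k , ∘ᶜ-run d D a r

-- Encoding and splicing

isz≤1 : ∀ n → isz n ≤ 1
isz≤1 zero    = ≤-refl
isz≤1 (suc n) = z≤n

lt-true : ∀ {m n} → m < n → lt m n ≡ 1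
lt-true {m} {n} h = ≤-antisym (isz≤1 (sub (suc m) n)) (from (lt-T m n) h)

lt-false : ∀ {m n} → n ≤ m → lt m n ≡ 0
lt-false {m} {n} h = ¬True⇒≡0 (≤⇒≯ h ∘ to (lt-T m n))

sum-lt : ∀ a n → sum (λ t → lt t a) n ≡ n ⊓ a
sum-lt a zero    = refl
sum-lt a (suc n) with n <? a
... | yes n<a = trans (cong₂ _+_ (lt-true n<a) (trans (sum-lt a n) (m≤n⇒m⊓n≡m (<⇒≤ n<a))))
  (sym (m≤n⇒m⊓n≡m n<a))
... | no  n≮a = let a≤n = ≮⇒≥ n≮a in
  trans (cong₂ _+_ (lt-false a≤n) (trans (sum-lt a n) (m≥n⇒m⊓n≡n a≤n))) (sym (m≥n⇒m⊓n≡n (m≤n⇒m≤1+n a≤n)))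

sum≤ : ∀ {f} n → (∀ a → f a ≤ 1) → sum f n ≤ n
sum≤ zero    h = z≤n
sum≤ (suc n) h = +-mono-≤ (h n) (sum≤ n h)

decode<base : ∀ {h} → 2^ℕ h → ∀ q → decode h q < base q
decode<base b q = s≤s (sum≤ (base′ q) λ t → s≤s⁻¹ (b (pairℕ q t)))

-- Undone by `decode` on points below `base`: the value at `q` is written in unary, behind the
-- label.
encode : ℕ → Baire → Baire
encode i x m = cond m (lt (π₂ (prd m)) (x (π₁ (prd m)))) i

decode-encode : ∀ i x q → x q < base q → decode (tail (encode i x)) q ≡ x q
decode-encode i x q (s≤s x≤b) = trans
  (sum-cong (base′ q) λ t _ → cong₂ lt (π₂-pair q t) (cong x (π₁-pair q t)))
  (trans (sum-lt (x q) (base′ q)) (m≥n⇒m⊓n≡n x≤b))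

encode<2 : ∀ {i} x → i < 2 → 2^ℕ (encode i x)
encode<2 x i<2 zero    = i<2
encode<2 x i<2 (suc m) = s≤s (isz≤1 (sub (suc (π₂ m)) (x (π₁ m))))

-- The class for the side `i` before it is encoded into Cantor space, the form in which sides are
-- compared.
Meets : ℕ → Baire → Set
Meets i x = ∀ q → x q < base q × (π₁ q ≡ i → ¬ Killed q (x q))

Meets⇒Obeys : ∀ {i x} → Meets i x → ∀ q → Obeys (encode i x) q
Meets⇒Obeys {i} {x} h q e = subst (¬_ ∘ Killed q) (sym (decode-encode i x q (proj₁ (h q)))) (proj₂ (h q) e)

Labelled⇒Meets : ∀ {y} → Labelled y → Meets (y 0) (decode (tail y))
Labelled⇒Meets (b , o) q = decode<base (λ n → b (suc n)) q , o q

-- A finite part of `g` stored as constants: `g` may fail to be computable, and the program reading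
-- it has another point as oracle.
table : Baire → ℕ → Baire
table g zero    n = 0
table g (suc m) n = cond (eq n m) (g m) (table g m n)

table-≡ : ∀ g m n → n < m → table g m n ≡ g n
table-≡ g (suc m) n n<1+m with n ≟ m
... | yes refl = cond-true (g m) (table g m m) (from (eq-T m m) refl)
... | no n≢m   = trans (cond-false (g m) (table g m n) (n≢m ∘ to (eq-T n m)))
  (table-≡ g m n (≤∧≢⇒< (s≤s⁻¹ n<1+m) n≢m))

table<2 : ∀ {g} → 2^ℕ g → ∀ m → 2^ℕ (table g m)
table<2 b zero    n = z<s
table<2 {g} b (suc m) n = cond<2 (eq n m) (b m) (table<2 b m n)
  where
  cond<2 : ∀ c {x y} → x < 2 → y < 2 → cond c x y < 2
  cond<2 zero    p q = q
  cond<2 (suc c) p q = p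

table-c : ∀ g m → Cmp (λ _ n → table g m n)
table-c g zero    = const-c 0
table-c g (suc m) = cond-c (eq-c id-c (const-c m)) (const-c (g m)) (table-c g m)

encode-c : ∀ i → Cmp (λ x n → encode i x (π₂ n))
encode-c i = cond-c tail-c (lt-c (π₂-c (prd-c tail-c)) (oracle-c (π₁-c (prd-c tail-c)))) (const-c i)

-- The entries of the rows up to m that matter for membership in Rowwise lie below scope m.
scope : ℕ → ℕ
scope m = suc (pairℕ m (suc (pairℕ m (base′ m))))

base′-mono : ∀ {m n} → m ≤ n → base′ m ≤ base′ n
base′-mono h = *-mono-≤ (s≤s (cap-mono h)) (cap-mono h)

Obeys-local : ∀ {g g′ k q} m → (∀ n → π₁ n ≡ k → n < scope m → g n ≡ g′ n) → k ≤ m → q < k →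
  Obeys (row g k) q → Obeys (row g′ k) q
Obeys-local {g} {g′} {k} {q} m e k≤m q<k = Obeys-resp (row g k) (row g′ k) q
  (e (pairℕ k 0) (π₁-pair k 0) (s≤s (pair-mono k≤m (z≤n {suc (pairℕ m (base′ m))}))))
  λ t t<b → e (pairℕ k (suc (pairℕ q t))) (π₁-pair k (suc (pairℕ q t))) (s≤s (pair-mono k≤m (s≤s (pair-mono q≤m
    (≤-trans (<⇒≤ t<b) (base′-mono q≤m))))))
  where
  q≤m : q ≤ m
  q≤m = ≤-trans (<⇒≤ q<k) k≤m

_agrees_below_ : Baire → Baire → ℕ → Set
g agrees h below n = ∀ j → j < n → g j ≡ h j

-- Each constraint reads finitely many entries of one row, so it can be checked on an approximation
-- that agrees far enough.
Rowwise-closed : ∀ {g} → (∀ n → ∃[ h ] Rowwise h × g agrees h below n) → Rowwise g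
Rowwise-closed {g} approx = bits , λ k q q<k → let h , (_ , o) , e = approx (scope k) in
  Obeys-local {g = h} {g′ = g} {k} {q} k (λ n _ n<s → sym (e n n<s)) ≤-refl q<k (o k q q<k)
  where
  bits : 2^ℕ g
  bits n = let h , (b , _) , e = approx (suc n) in subst (_< 2) (sym (e n ≤-refl)) (b n)

opaque
  -- Feeds a point `x` of side `i` to a program whose behaviour is known near `g` only. The first
  -- `m` rows retain every entry that their constraints read.
  splice : Baire → ℕ → ℕ → Baire → Baire
  splice g m i x n = cond (lt (π₁ n) m) (table g (scope m) n) (encode i x (π₂ n))

  splice-old : ∀ g m i x n → π₁ n < m → splice g m i x n ≡ table g (scope m) n
  splice-old g m i x n h = cond-true (table g (scope m) n) (encode i x (π₂ n)) (from (lt-T (π₁ n) m) h)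

  splice-new : ∀ g m i x n → m ≤ π₁ n → splice g m i x n ≡ encode i x (π₂ n)
  splice-new g m i x n h = cond-false (table g (scope m) n) (encode i x (π₂ n)) (≤⇒≯ h ∘ to (lt-T (π₁ n) m))

  splice-c : ∀ g m i → Cmp (λ x n → splice g m i x n)
  splice-c g m i = cond-c (lt-c v0 (const-c m)) (table-c g (scope m)) (encode-c i)

-- A position below `m` lies in a row below `m` and within the stored table.
splice-agrees : ∀ g m i x → splice g m i x agrees g below m
splice-agrees g m i x n n<m = trans (splice-old g m i x n (≤-<-trans π₁n≤n n<m))
  (table-≡ g (scope m) n (≤-trans n<m (≤-trans (x≤pair m (suc (pairℕ m (base′ m)))) (n≤1+n _))))
  where
  π₁n≤n : π₁ n ≤ n
  π₁n≤n = subst (π₁ n ≤_) (pair-unpair n) (x≤pair (π₁ n) (π₂ n))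

splice-Rowwise : ∀ g m i x → 2^ℕ g → (∀ k q → k < m → q < k → Obeys (row g k) q) → i < 2 → Meets i x →
  Rowwise (splice g m i x)
splice-Rowwise g m i x b old i<2 new = bits , obeys
  where
  bits : 2^ℕ (splice g m i x)
  bits n with π₁ n <? m
  ... | yes h = subst (_< 2) (sym (splice-old g m i x n h)) (table<2 b (scope m) n)
  ... | no ¬h = subst (_< 2) (sym (splice-new g m i x n (≮⇒≥ ¬h))) (encode<2 x i<2 (π₂ n))
  obeys : ∀ k q → q < k → Obeys (row (splice g m i x) k) q
  obeys k q q<k with k <? m
  ... | yes k<m = Obeys-local {g = g} {g′ = splice g m i x} {k} {q} m
    (λ n e n<s → sym (trans (splice-old g m i x n (subst (_< m) (sym e) k<m)) (table-≡ g (scope m) n n<s)))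
    (<⇒≤ k<m) q<k (old k q k<m q<k)
  ... | no k≮m = Obeys-resp (encode i x) (row (splice g m i x) k) q (entry 0)
    (λ t _ → entry (suc (pairℕ q t))) (Meets⇒Obeys new q)
    where
    entry : ∀ n → encode i x n ≡ splice g m i x (pairℕ k n)
    entry n = sym (trans (splice-new g m i x (pairℕ k n) (subst (m ≤_) (sym (π₁-pair k n)) (≮⇒≥ k≮m)))
      (cong (encode i x) (π₂-pair k n)))

↾-cong : ∀ n {g h} → g agrees h below n → g ↾ n ≡ h ↾ n
↾-cong zero    e = refl
↾-cong (suc n) e = cong₂ _∷_ (e 0 z<s) (↾-cong n λ j j<n → e (suc j) (s≤s j<n))

-- Failure of a single learner

module _ (em : ExcludedMiddle 0ℓ) where

  -- The diagonal point waives only a constraint of side `i`, so it lies in the class for `i′`; but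
  -- the output at that `q` would be below `base q` and not killed, which `diagonal` forbids.
  incomparable : ∀ {i i′} → i ≢ i′ → ∀ c →
    ¬ (∀ x → Meets i′ x → ∃[ y ] Meets i y × (∀ q → ⟦ c ⟧ x q (y q)))
  incomparable {i} {i′} i≢i′ c h =
    let x , A , none = diagonal em i c
        y , M , run = h x λ j → proj₁ (A j) , λ e → proj₂ (A j) λ j≡q →
          i≢i′ (trans (sym (π₁-pair i ⌜ c ⌝)) (trans (cong π₁ (sym j≡q)) e))
        y<b , ¬k = M (pairℕ i ⌜ c ⌝) in
    none (y (pairℕ i ⌜ c ⌝)) y<b (¬k (π₁-pair i ⌜ c ⌝)) (run (pairℕ i ⌜ c ⌝))

  meets : ∀ i → ∃[ x ] Meets i x
  -- A point built against side `suc i` waives no constraint of side `i`.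
  meets i = let x , A , _ = diagonal em (suc i) zeroᶜ in
    x , λ j → proj₁ (A j) , λ e → proj₂ (A j) λ { refl →
      contradiction (trans (sym (π₁-pair (suc i) ⌜ zeroᶜ ⌝)) e) 1+n≢n }

  Rowwise-inhabited : ∃[ g ] Rowwise g
  Rowwise-inhabited = let x , m = meets 0 in
    splice (λ _ → 0) 0 0 x , splice-Rowwise (λ _ → 0) 0 0 x (λ _ → z<s) (λ _ _ ()) z<s m

  -- Otherwise Ψ would change its mind infinitely often on a limit of points of S.
  stable : ∀ {S : Pred Baire 0ℓ} → (∀ {g} → (∀ n → ∃[ h ] S h × g agrees h below n) → S g) →
    (∃[ g ] S g) → ∀ Ψ → (∀ g → S g → ∃[ l ] (λ n → Ψ (g ↾ n)) convergesTo l) →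
    ∃[ g ] ∃[ N ] S g × (∀ h → S h → h agrees g below N → ∀ n → N ≤ n → Ψ (h ↾ n) ≡ Ψ (g ↾ N))
  stable {S} closed (g₀ , s₀) Ψ conv
    with em {∃[ g ] ∃[ N ] S g × (∀ h → S h → h agrees g below N → ∀ n → N ≤ n → Ψ (h ↾ n) ≡ Ψ (g ↾ N))}
  ... | yes p = p
  ... | no ¬p = contradiction (trans (proj₂ (proj₂ (conv G S-G)) (N (suc s)) s≤N₁)
        (sym (proj₂ (proj₂ (conv G S-G)) (N s) s≤N)))
      λ e → proj₂ (proj₂ (proj₂ (proj₂ (change (pt s) (N s) (S-pt s)))))
        (trans (sym (cong Ψ (↾-cong (N (suc s)) (proj₂ lim (suc s))))) (trans e (cong Ψ (↾-cong (N s) (proj₂ lim s)))))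
    where
    change : ∀ g N → S g → ∃[ h ] ∃[ n ] S h × (h agrees g below N × N ≤ n) × Ψ (h ↾ n) ≢ Ψ (g ↾ N)
    change g N s with em {∃[ h ] ∃[ n ] S h × (h agrees g below N × N ≤ n) × Ψ (h ↾ n) ≢ Ψ (g ↾ N)}
    ... | yes q = q
    ... | no ¬q = contradiction (g , N , s , λ h t e n N≤n → same h t e n N≤n) ¬p
      where
      same : ∀ h → S h → h agrees g below N → ∀ n → N ≤ n → Ψ (h ↾ n) ≡ Ψ (g ↾ N)
      same h t e n N≤n with Ψ (h ↾ n) ≟ Ψ (g ↾ N)
      ... | yes r = r
      ... | no ¬r = contradiction (h , n , t , (e , N≤n) , ¬r) ¬q
    State : Set
    State = ∃[ g ] ℕ × S g
    step : State → State
    step (g , N , s) = let h , n , t , _ = change g N s in h , n , t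
    state : ℕ → State
    state zero    = g₀ , 0 , s₀
    state (suc k) = step (state k)
    pt : ℕ → Baire
    pt k = proj₁ (state k)
    N : ℕ → ℕ
    N k = proj₁ (proj₂ (state k))
    S-pt : ∀ k → S (pt k)
    S-pt k = proj₂ (proj₂ (state k))
    ag : ∀ k → pt (suc k) agrees pt k below N k
    ag k = proj₁ (proj₁ (proj₂ (proj₂ (proj₂ (change (pt k) (N k) (S-pt k))))))
    inc : ∀ k → N k < N (suc k)
    inc k = let _ , _ , _ , (_ , N≤n) , ne = change (pt k) (N k) (S-pt k) in
      -- At equal lengths the two prefixes, and hence the guesses, would coincide.
      ≤∧≢⇒< N≤n λ e → ne (trans (cong (λ n → Ψ (pt (suc k) ↾ n)) (sym e)) (cong Ψ (↾-cong (N k) (ag k))))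
    lim : ∃[ X ] ∀ k j → j < N k → X j ≡ pt k j
    lim = limit pt N inc ag
    k≤N : ∀ k → k ≤ N k
    k≤N = increasing⇒≥ inc
    G : Baire
    G = proj₁ lim
    S-G : S G
    S-G = closed λ n → pt n , S-pt n , λ j j<n → proj₂ lim n j (≤-trans j<n (k≤N n))
    s : ℕ
    s = proj₁ (proj₂ (conv G S-G))
    s≤N : s ≤ N s
    s≤N = k≤N s
    s≤N₁ : s ≤ N (suc s)
    s≤N₁ = ≤-trans s≤N (<⇒≤ (inc s))

  no-local-reduction : ∀ {e g N} → Rowwise g →
    ¬ (∀ g′ → Rowwise g′ → g′ agrees g below N → ∃[ h ] Labelled h × Φ e g′ h)
  no-local-reduction {e} {g} {N} p red with red g p (λ _ _ → refl)
  ... | h₀ , q₀ , f₀ with f₀ 0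
  ... | c , refl , run₀ = incomparable {i} {1 ∸ i} (flip i (proj₁ q₀ 0)) (proj₁ D ∘ᶜ (c ∘ᶜ proj₁ Z)) transform
    where
    i M : ℕ
    i = h₀ 0
    -- Agreement with `g` below `M` keeps a point where the reduction works and preserves the
    -- computation of the label `i`.
    M = N ⊔ proj₁ (use c run₀)
    flip : ∀ i → i < 2 → i ≢ 1 ∸ i
    flip zero          _ ()
    flip (suc zero)    _ ()
    flip (suc (suc i)) (s≤s (s≤s ())) _
    Z : Cmp (λ x n → splice g M (1 ∸ i) x n)
    Z = splice-c g M (1 ∸ i)
    D : Cmp (λ y q → decode (tail y) q)
    D = sum-c {f = λ y q t → y (suc (pairℕ q t))} (base′-c id-c) (oracle-c (suc-c (pair-c tail-c v0)))
    transform : ∀ x → Meets (1 ∸ i) x →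
      ∃[ y ] Meets i y × (∀ q → ⟦ proj₁ D ∘ᶜ (c ∘ᶜ proj₁ Z) ⟧ x q (y q))
    transform x m = decode (tail h) , subst (λ j → Meets j (decode (tail h))) h0≡i (Labelled⇒Meets q) ,
        λ n → ∘ᶜ-run {h = h} (c ∘ᶜ proj₁ Z) (λ n → ∘ᶜ-run {h = z} (proj₁ Z) (proj₂ Z x) c {n} (run n))
          (proj₁ D) {n} (proj₂ D h n)
      where
      z : Baire
      z = splice g M (1 ∸ i) x
      agree : ∀ {n} → n ≤ M → z agrees g below n
      agree n≤M j j<n = splice-agrees g M (1 ∸ i) x j (≤-trans j<n n≤M)
      r : ∃[ h ] Labelled h × Φ ⌜ c ⌝ z h
      r = red z (splice-Rowwise g M (1 ∸ i) x (proj₁ p) (λ k q _ → proj₂ p k q) (s≤s (m∸n≤m 1 i)) m)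
        (agree (m≤m⊔n N _))
      h : Baire
      h = proj₁ r
      q : Labelled h
      q = proj₁ (proj₂ r)
      run : ∀ n → ⟦ c ⟧ z n (h n)
      run n = let c′ , e , t = proj₂ (proj₂ r) n in subst (λ d → ⟦ d ⟧ z n (h n)) (⌜⌝-injective c′ c e) t
      h0≡i : h 0 ≡ i
      h0≡i = ⟦⟧-functional c (run 0) (proj₂ (use c run₀) z (agree (m≤n⊔m N _)))

  -- On the neighbourhood supplied by `stable` the learner always converges to the guess
  -- `Ψ (g ↾ N)`, so one program reduces there.
  Labelled≰Rowwise : Labelled ≰[ ⟨1,ω⟩ ] Rowwise
  Labelled≰Rowwise (Γ , (_ , Ψ , _ , ident) , Rowwise⊆dom , values) = no-local-reduction p local
    where
    st : ∃[ g ] ∃[ N ] Rowwise g × (∀ h → Rowwise h → h agrees g below N → ∀ n → N ≤ n → Ψ (h ↾ n) ≡ Ψ (g ↾ N))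
    st = stable Rowwise-closed Rowwise-inhabited Ψ λ g p → let l , cv , _ = ident g (Rowwise⊆dom p) in l , cv
    g = proj₁ st
    N = proj₁ (proj₂ st)
    p = proj₁ (proj₂ (proj₂ st))
    local : ∀ g′ → Rowwise g′ → g′ agrees g below N → ∃[ h ] Labelled h × Φ (Ψ (g ↾ N)) g′ h
    local g′ p′ ag = let l , (s , cv) , h , γ , f = ident g′ (Rowwise⊆dom p′) in
      h , values g′ p′ h γ , subst (λ e → Φ e g′ h)
        (trans (sym (cv (s ⊔ N) (m≤m⊔n s N))) (proj₂ (proj₂ (proj₂ st)) g′ p′ ag (s ⊔ N) (m≤n⊔m s N))) f

corollary14 : ExcludedMiddle 0ℓ →
    (∃[ P ] ∃[ Q ] Π⁰₁ P × Π⁰₁ Q × P ≡[ ⟨<ω,1⟩ ] Q × Q ≰[ ⟨1,ω⟩ ] P)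
    × (∃[ P ] ∃[ Q ] Π⁰₁ P × Π⁰₁ Q × P ≡[ ⟨<ω,ω⟩ ] Q × P <[ ⟨1,ω⟩ ] Q)
corollary14 em =
    -- One pair of classes serves both claims; the reduction by two programs carries over to
    -- constant learners.
    (Rowwise , Labelled , Π⁰₁-Rowwise , Π⁰₁-Labelled
      , (Rowwise≤Labelled ⟨<ω,1⟩ ΦFun-<ω1 , Labelled≤Rowwise em) , Labelled≰Rowwise em)
  , (Rowwise , Labelled , Π⁰₁-Rowwise , Π⁰₁-Labelled
      , (weaken (λ {Γ} → <ω1⇒<ωω {Γ}) (Rowwise≤Labelled ⟨<ω,1⟩ ΦFun-<ω1)
        , weaken (λ {Γ} → <ω1⇒<ωω {Γ}) (Labelled≤Rowwise em))
      , Rowwise≤Labelled ⟨1,ω⟩ ΦFun-1ω , Labelled≰Rowwise em)
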